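{- For every integer $h \ge 2$ there exists a set $A$ of positive integers which is simultaneously an asymptotic basis of order $2h$ and a $B_h[1]$-set.
   Context: For a set $A$ of positive integers and integers $k\ge 1$, $n \ge 0$, let $R_{k,A}(n)$ denote the number of solutions of $a_1 + a_2 + \dots + a_k = n$ with $a_1,\dots,a_k \in A$ and $a_1 \le a_2 \le \dots \le a_k$. A set $A$ is an asymptotic basis of order $k$ if there is $n_0$ such that $R_{k,A}(n) > 0$ for all $n > n_0$. A set $A$ is a $B_h[g]$-set if $R_{h,A}(n) \le g$ for every $n \ge 0$. -}

module Defs where

open import Level using (0ℓ)
open import Data.Nat.Base using (ℕ; zero; suc; _≤_; _<_; _>_; s≤s)
open import Data.Nat.Properties
  using (_≟_; _≤?_; ≤-trans; m≤m+n; m≤n+m; ≤-reflexive)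
open import Data.Product.Base using (_×_; _,_; proj₁; proj₂; ∃-syntax)
open import Data.List.Base
  using (List; [_]; filter; length; upTo; cartesianProductWith)
open import Data.List.Membership.Propositional using (_∈_)
open import Data.List.Membership.Propositional.Properties
  using (∈-cartesianProductWith⁺; ∈-upTo⁺; ∈-filter⁺; ∈-filter⁻)
open import Data.List.Relation.Unary.Any using (here)
open import Data.List.Relation.Unary.Unique.Propositional using (Unique; []; _∷_)
import Data.List.Relation.Unary.All as ListAll
import Data.List.Relation.Unary.Unique.Propositional.Properties as Unique
open import Data.Vec.Base using (Vec; []; _∷_; sum)
open import Data.Vec.Properties using (∷-injective)
open import Data.Vec.Relation.Unary.All using (All; []; _∷_; all?)
open import Data.Vec.Relation.Unary.Linked using (Linked; linked?)
open import Relation.Binary.PropositionalEquality using (_≡_; refl)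
open import Relation.Nullary.Decidable using (_×-dec_)
open import Relation.Unary using (Pred; Decidable)

-- Membership is decidable so that the representation function is an actual
-- ℕ-valued function.
record PositiveSet : Set₁ where
  field
    Member   : Pred ℕ 0ℓ
    member?  : Decidable Member
    positive : ∀ {a} → Member a → 0 < a

open PositiveSet public

IsRepresentation : ∀ {k} → PositiveSet → ℕ → Pred (Vec ℕ k) 0ℓ
IsRepresentation A n as = All (Member A) as × Linked _≤_ as × sum as ≡ n

isRepresentation? : ∀ {k} A n → Decidable (IsRepresentation {k} A n)
isRepresentation? A n as =
  all? (member? A) as ×-dec linked? _≤?_ as ×-dec sum as ≟ n

tuples : List ℕ → ∀ k → List (Vec ℕ k)
tuples xs zero    = [ [] ]
tuples xs (suc k) = cartesianProductWith _∷_ xs (tuples xs k)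

-- Each term of a sum equal to n is at most n, so searching k-tuples with
-- entries in {0, …, n} misses nothing; see ∈-representations⁺ below.
representations : ∀ k → PositiveSet → ∀ n → List (Vec ℕ k)
representations k A n = filter (isRepresentation? A n) (tuples (upTo (suc n)) k)

R : ℕ → PositiveSet → ℕ → ℕ
R k A n = length (representations k A n)

IsAsymptoticBasis : ℕ → PositiveSet → Set
IsAsymptoticBasis k A = ∃[ n₀ ] (∀ n → n > n₀ → R k A n > 0)

-- B_h[g]-sets.
IsB : (h g : ℕ) → PositiveSet → Set
IsB h g A = ∀ n → R h A n ≤ g

-- representations k A n lists every solution exactly once.

∈-tuples⁺ : ∀ {xs k} {as : Vec ℕ k} → All (_∈ xs) as → as ∈ tuples xs k
∈-tuples⁺ []       = here refl
∈-tuples⁺ (p ∷ ps) = ∈-cartesianProductWith⁺ _∷_ p (∈-tuples⁺ ps)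

sum≤⇒All∈upTo : ∀ {k} n (as : Vec ℕ k) → sum as ≤ n → All (_∈ upTo (suc n)) as
sum≤⇒All∈upTo n []       _ = []
sum≤⇒All∈upTo n (a ∷ as) p =
  ∈-upTo⁺ (s≤s (≤-trans (m≤m+n a (sum as)) p)) ∷
  sum≤⇒All∈upTo n as (≤-trans (m≤n+m (sum as) a) p)

∈-representations⁺ : ∀ {k} A {n} {as : Vec ℕ k} →
                     IsRepresentation A n as → as ∈ representations k A n
∈-representations⁺ A {n} {as} p@(_ , _ , sum≡n) =
  ∈-filter⁺ (isRepresentation? A n)
    (∈-tuples⁺ (sum≤⇒All∈upTo n as (≤-reflexive sum≡n))) p

∈-representations⁻ : ∀ {k} A {n} {as : Vec ℕ k} →
                     as ∈ representations k A n → IsRepresentation A n as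
∈-representations⁻ {k} A {n} p =
  proj₂ (∈-filter⁻ (isRepresentation? A n) {xs = tuples (upTo (suc n)) k} p)

tuples-unique : ∀ {xs} k → Unique xs → Unique (tuples xs k)
tuples-unique zero    _ = ListAll.[] ∷ []
tuples-unique (suc k) u =
  Unique.cartesianProductWith⁺ _∷_ ∷-injective u (tuples-unique k u)

representations-unique : ∀ k A n → Unique (representations k A n)
representations-unique k A n =
  Unique.filter⁺ (isRepresentation? A n)
    (tuples-unique k (Unique.upTo⁺ (suc n)))

{-# OPTIONS --safe #-}

-- Write H = 2h.  The set is built greedily: given a finite B_h[1]-set A and a
-- finite set U of integers of size about V, draw H groups of k random numbers
-- from a window of length V, and keep those which solve no equation
-- c x + Σα = Σβ with at most h terms on each side over A and the other numbers
-- drawn.  What is kept extends A to a B_h[1]-set.  A given u ∈ U is the sum of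
-- one number from each group about k^H / V times on average.  For a fixed
-- choice of one number from each group, having sum u and one further equation
-- involving a chosen number determines two of the coordinates: none of these
-- equations gives all H chosen numbers the same coefficient, as H > h.  So
-- each further equation costs a factor 1/V, and as long as |A|^(H-1) and k^H
-- are small compared with V, a proportion of about k^H / V of U is covered by
-- a suitable draw.  Repeating this uses up U with about (V / k^H) log V draws;
-- with k slightly below V^(1/H) this keeps |A|^(H-1) small compared with V.
-- Doing so for longer and longer intervals U gives the basis.
module Submission where

open import Defs
open import Data.Nat.Base using (ℕ; zero; suc; _+_; _*_; _∸_; _^_; _≤_; _<_; _>_; z≤n; s≤s; s≤s⁻¹; >-nonZero)
open import Data.Nat.Properties
open import Data.Nat.Solver using (module +-*-Solver)
open import Data.Product.Base using (_×_; _,_; proj₁; proj₂; ∃-syntax)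
open import Data.Sum.Base using (_⊎_; inj₁; inj₂; [_,_]′)
open import Data.Sum.Properties using (inj₂-injective) renaming (≡-dec to ⊎-≡-dec)
open import Data.Empty using (⊥; ⊥-elim)
open import Data.Fin.Base using (Fin; zero; suc; combine)
open import Data.Fin.Properties
  using (all?; any?; pigeonhole; combine-injectiveˡ; combine-injectiveʳ; ¬∀⟶∃¬)
  renaming (<⇒≢ to <⇒≢ᶠ; _≟_ to _≟ᶠ_; suc-injective to suc-injectiveᶠ)
open import Data.List.Base
  using (List; []; _∷_; _++_; length; map; filter; upTo; allFin; applyUpTo; cartesianProduct; cartesianProductWith)
open import Data.List.Properties
  using (length-applyUpTo; length-upTo; length-map; length-++; length-tabulate; length-filter)
open import Data.List.Membership.Propositional using (_∈_; _∉_; find; lose)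
open import Data.List.Membership.DecPropositional _≟_ using (_∈?_)
open import Data.List.Membership.Propositional.Properties
open import Data.List.Relation.Unary.Any as Any using (Any; here; there)
import Data.List.Relation.Unary.All as ListAll
open import Data.List.Relation.Unary.Unique.Propositional using (Unique; []; _∷_)
import Data.List.Relation.Unary.Unique.Propositional.Properties as Unique
open import Data.Vec.Base as Vec using (Vec; []; _∷_; sum; lookup; tabulate; _[_]≔_)
open import Data.Vec.Properties using (lookup∘update; lookup∘update′; tabulate-∘; ∷-injective; ≡-dec)
import Data.Vec.Membership.DecPropositional as DecVec
open import Data.Vec.Membership.Propositional using () renaming (_∈_ to _∈ᵛ_; _∉_ to _∉ᵛ_)
open import Data.Vec.Membership.Propositional.Properties using () renaming (∈-tabulate⁺ to ∈ᵛ-tabulate⁺)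
import Data.Vec.Relation.Unary.Any as VecAny
import Data.Vec.Relation.Unary.Any.Properties as VecAny
open import Data.Vec.Relation.Unary.All as All using (All; []; _∷_)
import Data.Vec.Relation.Unary.All.Properties as All
open import Data.Vec.Relation.Unary.Linked as Linked using (Linked; []; [-]; _∷_)
open import Data.Vec.Relation.Unary.Linked.Properties using (Linked⇒All)
open import Function.Base using (_∘_; id)
open import Level using (0ℓ)
open import Relation.Binary.Definitions using (tri<; tri≈; tri>)
open import Relation.Binary.PropositionalEquality
open import Relation.Nullary using (¬_; Dec; yes; no)
open import Relation.Nullary.Decidable using (¬?; _×-dec_; decidable-stable)
open import Relation.Unary using (Pred; Decidable)

open +-*-Solver using (solve; _:+_; _:*_; _:=_; con)

private variable
  T T′ T″ Φ Ψ : Set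
  K k m n     : ℕ
  ω ω′        : Vec ℕ K

-- Finite sums

∑ : List T → (T → ℕ) → ℕ
∑ []       f = 0
∑ (x ∷ xs) f = f x + ∑ xs f

infix 5 ∑
syntax ∑ xs (λ x → e) = ∑[ x ∈ xs ] e

∑-mono-∈ : (xs : List T) {f g : T → ℕ} → (∀ {x} → x ∈ xs → f x ≤ g x) → ∑ xs f ≤ ∑ xs g
∑-mono-∈ []       h = z≤n
∑-mono-∈ (x ∷ xs) h = +-mono-≤ (h (here refl)) (∑-mono-∈ xs (h ∘ there))

∑-mono : (xs : List T) {f g : T → ℕ} → (∀ x → f x ≤ g x) → ∑ xs f ≤ ∑ xs g
∑-mono xs h = ∑-mono-∈ xs (λ {x} _ → h x)

∑-cong : (xs : List T) {f g : T → ℕ} → (∀ x → f x ≡ g x) → ∑ xs f ≡ ∑ xs g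
∑-cong []       h = refl
∑-cong (x ∷ xs) h = cong₂ _+_ (h x) (∑-cong xs h)

∑-const : (xs : List T) (c : ℕ) → ∑ xs (λ _ → c) ≡ length xs * c
∑-const []       c = refl
∑-const (x ∷ xs) c = cong (c +_) (∑-const xs c)

∑-≤-const : (xs : List T) {f : T → ℕ} {c : ℕ} → (∀ {x} → x ∈ xs → f x ≤ c) → ∑ xs f ≤ length xs * c
∑-≤-const xs {c = c} h = ≤-trans (∑-mono-∈ xs h) (≤-reflexive (∑-const xs c))

∑-distrib-+ : (xs : List T) (f g : T → ℕ) → ∑ xs (λ x → f x + g x) ≡ ∑ xs f + ∑ xs g
∑-distrib-+ []       f g = refl
∑-distrib-+ (x ∷ xs) f g = begin
  f x + g x + ∑ xs (λ x → f x + g x) ≡⟨ cong (f x + g x +_) (∑-distrib-+ xs f g) ⟩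
  f x + g x + (∑ xs f + ∑ xs g)      ≡⟨ +-assoc (f x) (g x) _ ⟩
  f x + (g x + (∑ xs f + ∑ xs g))    ≡⟨ cong (f x +_) (+-assoc (g x) (∑ xs f) _) ⟨
  f x + (g x + ∑ xs f + ∑ xs g)      ≡⟨ cong (λ t → f x + (t + ∑ xs g)) (+-comm (g x) _) ⟩
  f x + (∑ xs f + g x + ∑ xs g)      ≡⟨ cong (f x +_) (+-assoc (∑ xs f) (g x) _) ⟩
  f x + (∑ xs f + (g x + ∑ xs g))    ≡⟨ +-assoc (f x) (∑ xs f) _ ⟨
  f x + ∑ xs f + (g x + ∑ xs g)      ∎
  where open ≡-Reasoning

*-distribˡ-∑ : (xs : List T) (c : ℕ) (f : T → ℕ) → c * ∑ xs f ≡ ∑ xs (λ x → c * f x)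
*-distribˡ-∑ []       c f = *-zeroʳ c
*-distribˡ-∑ (x ∷ xs) c f =
  trans (*-distribˡ-+ c (f x) (∑ xs f)) (cong (c * f x +_) (*-distribˡ-∑ xs c f))

∑-comm : (xs : List T) (ys : List T′) (f : T → T′ → ℕ) →
         ∑ xs (λ x → ∑ ys (f x)) ≡ ∑ ys (λ y → ∑ xs (λ x → f x y))
∑-comm []       ys f = sym (trans (∑-const ys 0) (*-zeroʳ (length ys)))
∑-comm (x ∷ xs) ys f =
  trans (cong (∑ ys (f x) +_) (∑-comm xs ys f)) (sym (∑-distrib-+ ys (f x) _))

∑-map : (g : T → T′) (xs : List T) (f : T′ → ℕ) → ∑ (map g xs) f ≡ ∑ xs (f ∘ g)
∑-map g []       f = refl
∑-map g (x ∷ xs) f = cong (f (g x) +_) (∑-map g xs f)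

∑-++ : (xs ys : List T) (f : T → ℕ) → ∑ (xs ++ ys) f ≡ ∑ xs f + ∑ ys f
∑-++ []       ys f = refl
∑-++ (x ∷ xs) ys f = trans (cong (f x +_) (∑-++ xs ys f)) (sym (+-assoc (f x) _ _))

∑-cartesianProductWith : (g : T → T′ → T″) (xs : List T) (ys : List T′) (f : T″ → ℕ) →
  ∑ (cartesianProductWith g xs ys) f ≡ ∑ xs (λ x → ∑ ys (λ y → f (g x y)))
∑-cartesianProductWith g []       ys f = refl
∑-cartesianProductWith g (x ∷ xs) ys f =
  trans (∑-++ (map (g x) ys) _ f)
        (cong₂ _+_ (∑-map (g x) ys f) (∑-cartesianProductWith g xs ys f))

∑-length : (xs : List T) → ∑ xs (λ _ → 1) ≡ length xs
∑-length xs = trans (∑-const xs 1) (*-identityʳ _)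

term≤∑ : {xs : List T} {x : T} (f : T → ℕ) → x ∈ xs → f x ≤ ∑ xs f
term≤∑ f (here refl) = m≤m+n _ _
term≤∑ f (there p)   = ≤-trans (term≤∑ f p) (m≤n+m _ _)

∑-positive : (xs : List T) (f : T → ℕ) → 0 < ∑ xs f → ∃[ x ] (x ∈ xs × 0 < f x)
∑-positive (x ∷ xs) f p with f x in eq
... | suc _ = x , here refl , subst (0 <_) (sym eq) (s≤s z≤n)
... | zero with ∑-positive xs f p
...   | y , y∈ , q = y , there y∈ , q

∑-≤1 : {xs : List T} (f : T → ℕ) → Unique xs → (∀ x → f x ≤ 1) →
       (∀ {x y} → 0 < f x → 0 < f y → x ≡ y) → ∑ xs f ≤ 1
∑-≤1 f []             f≤1 h = z≤n
∑-≤1 {xs = x ∷ xs} f (x≢ ∷ u) f≤1 h with f x in eq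
... | zero  = ∑-≤1 f u f≤1 h
... | suc k with ∑ xs f in eq′
...   | zero  = subst (_≤ 1) (trans eq (sym (+-identityʳ _))) (f≤1 x)
...   | suc _ with ∑-positive xs f (subst (0 <_) (sym eq′) (s≤s z≤n))
...     | y , y∈ , 0<fy =
  ⊥-elim (ListAll.lookup x≢ y∈ (h (subst (0 <_) (sym eq) (s≤s z≤n)) 0<fy))

∃≥average : (xs : List T) (f : T → ℕ) (c : ℕ) → 0 < length xs →
            length xs * c ≤ ∑ xs f → ∃[ x ] (x ∈ xs × c ≤ f x)
∃≥average (x ∷ xs) f c _ = go x xs
  where
  go : ∀ x xs → length (x ∷ xs) * c ≤ ∑ (x ∷ xs) f → ∃[ y ] (y ∈ x ∷ xs × c ≤ f y)
  go x []       h = x , here refl , subst₂ _≤_ (+-identityʳ c) (+-identityʳ (f x)) h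
  go x (y ∷ ys) h with c ≤? f x
  ... | yes c≤fx = x , here refl , c≤fx
  ... | no  c≰fx with go y ys (+-cancelˡ-≤ c _ _ (≤-trans h (+-monoˡ-≤ _ (<⇒≤ (≰⇒> c≰fx)))))
  ...   | z , z∈ , c≤fz = z , there z∈ , c≤fz

-- The Iverson bracket. Summed over a sample space it counts the favourable outcomes, which is how
-- probabilities are expressed.
⟦_⟧ : Dec Φ → ℕ
⟦ yes _ ⟧ = 1
⟦ no _ ⟧  = 0

⟦⟧≤1 : (d : Dec Φ) → ⟦ d ⟧ ≤ 1
⟦⟧≤1 (yes _) = ≤-refl
⟦⟧≤1 (no _)  = z≤n

⟦⟧-yes : (d : Dec Φ) → Φ → ⟦ d ⟧ ≡ 1
⟦⟧-yes (yes _) _ = refl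
⟦⟧-yes (no ¬p) p = ⊥-elim (¬p p)

⟦⟧-no : (d : Dec Φ) → ¬ Φ → ⟦ d ⟧ ≡ 0
⟦⟧-no (yes p) ¬p = ⊥-elim (¬p p)
⟦⟧-no (no _)  _  = refl

⟦⟧-pos : (d : Dec Φ) → 0 < ⟦ d ⟧ → Φ
⟦⟧-pos (yes p) _ = p

length-filter-¬ : {Ψ : Pred T 0ℓ} (Q? : Decidable Ψ) (xs : List T) →
                  ∑ xs (λ x → ⟦ Q? x ⟧) + length (filter (¬? ∘ Q?) xs) ≡ length xs
length-filter-¬ Q? []       = refl
length-filter-¬ Q? (x ∷ xs) with Q? x
... | yes _ = cong suc (length-filter-¬ Q? xs)
... | no  _ = trans (+-suc _ _) (cong suc (length-filter-¬ Q? xs))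

-- Finite product spaces

vecs : List T → ∀ k → List (Vec T k)
vecs xs zero    = [] ∷ []
vecs xs (suc k) = cartesianProductWith _∷_ xs (vecs xs k)

∑-vecs-suc : (xs : List T) (f : Vec T (suc n) → ℕ) →
             ∑ (vecs xs (suc n)) f ≡ ∑ xs (λ x → ∑ (vecs xs n) (λ v → f (x ∷ v)))
∑-vecs-suc xs f = ∑-cartesianProductWith _∷_ xs (vecs xs _) f

length-vecs : (xs : List T) (n : ℕ) → length (vecs xs n) ≡ length xs ^ n
length-vecs xs zero    = refl
length-vecs xs (suc n) = begin
  length (vecs xs (suc n))                     ≡⟨ ∑-length (vecs xs (suc n)) ⟨
  ∑ (vecs xs (suc n)) (λ _ → 1)                ≡⟨ ∑-vecs-suc xs (λ _ → 1) ⟩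
  ∑ xs (λ _ → ∑ (vecs xs n) (λ _ → 1))         ≡⟨ ∑-cong xs (λ _ → ∑-length (vecs xs n)) ⟩
  ∑ xs (λ _ → length (vecs xs n))              ≡⟨ ∑-const xs _ ⟩
  length xs * length (vecs xs n)               ≡⟨ cong (length xs *_) (length-vecs xs n) ⟩
  length xs * length xs ^ n                    ∎
  where open ≡-Reasoning

-- Averages over a product space

-- The head position is written last, so it prevails over later entries of the vector of positions.
write : Vec (Fin K) n → Vec T n → Vec T K → Vec T K
write []       []       ω = ω
write (p ∷ ps) (a ∷ as) ω = write ps as ω [ p ]≔ a

-- Stands in for moving the coordinate p to the front.
resample₁ : (xs : List T) (p : Fin K) (f : Vec T K → ℕ) →
            length xs * ∑ (vecs xs K) f ≡ ∑ (vecs xs K) (λ ω → ∑ xs (λ a → f (ω [ p ]≔ a)))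
resample₁ {K = suc K} xs zero f = begin
  length xs * ∑ (vecs xs (suc K)) f
    ≡⟨ cong (length xs *_) (∑-vecs-suc xs f) ⟩
  length xs * ∑ xs (λ x → ∑ (vecs xs K) (λ v → f (x ∷ v)))
    ≡⟨ cong (length xs *_) (∑-comm xs (vecs xs K) _) ⟩
  length xs * ∑ (vecs xs K) (λ v → ∑ xs (λ a → f (a ∷ v)))
    ≡⟨ ∑-const xs _ ⟨
  ∑ xs (λ _ → ∑ (vecs xs K) (λ v → ∑ xs (λ a → f (a ∷ v))))
    ≡⟨ ∑-vecs-suc xs (λ ω → ∑ xs (λ a → f (ω [ zero ]≔ a))) ⟨
  ∑ (vecs xs (suc K)) (λ ω → ∑ xs (λ a → f (ω [ zero ]≔ a))) ∎
  where open ≡-Reasoning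
resample₁ {K = suc K} xs (suc p) f = begin
  length xs * ∑ (vecs xs (suc K)) f
    ≡⟨ cong (length xs *_) (∑-vecs-suc xs f) ⟩
  length xs * ∑ xs (λ x → ∑ (vecs xs K) (λ v → f (x ∷ v)))
    ≡⟨ *-distribˡ-∑ xs (length xs) (λ x → ∑ (vecs xs K) (λ v → f (x ∷ v))) ⟩
  ∑ xs (λ x → length xs * ∑ (vecs xs K) (λ v → f (x ∷ v)))
    ≡⟨ ∑-cong xs (λ x → resample₁ xs p (λ v → f (x ∷ v))) ⟩
  ∑ xs (λ x → ∑ (vecs xs K) (λ v → ∑ xs (λ a → f (x ∷ v [ p ]≔ a))))
    ≡⟨ ∑-vecs-suc xs (λ ω → ∑ xs (λ a → f (ω [ suc p ]≔ a))) ⟨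
  ∑ (vecs xs (suc K)) (λ ω → ∑ xs (λ a → f (ω [ suc p ]≔ a))) ∎
  where open ≡-Reasoning

-- A form of Fubini that permutes no coordinates: an estimate may be proved for the written
-- coordinates alone, with the rest of `ω` frozen.
resample : (xs : List T) (ps : Vec (Fin K) n) (f : Vec T K → ℕ) →
           length xs ^ n * ∑ (vecs xs K) f ≡
           ∑ (vecs xs K) (λ ω → ∑ (vecs xs n) (λ as → f (write ps as ω)))
resample {K = K} xs [] f =
  trans (*-identityˡ _) (∑-cong (vecs xs K) (λ ω → sym (+-identityʳ (f ω))))
resample {K = K} {n = suc n} xs (p ∷ ps) f = begin
  length xs * length xs ^ n * ∑ Ω f
    ≡⟨ cong (_* ∑ Ω f) (*-comm (length xs) _) ⟩
  length xs ^ n * length xs * ∑ Ω f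
    ≡⟨ *-assoc (length xs ^ n) _ _ ⟩
  length xs ^ n * (length xs * ∑ Ω f)
    ≡⟨ cong (length xs ^ n *_) (resample₁ xs p f) ⟩
  length xs ^ n * ∑ Ω (λ ω → ∑ xs (λ a → f (ω [ p ]≔ a)))
    ≡⟨ resample xs ps _ ⟩
  ∑ Ω (λ ω → ∑ (vecs xs n) (λ as → ∑ xs (λ a → f (write ps as ω [ p ]≔ a))))
    ≡⟨ ∑-cong Ω (λ ω → trans (∑-comm (vecs xs n) xs _) (sym (∑-vecs-suc xs _))) ⟩
  ∑ Ω (λ ω → ∑ (vecs xs (suc n)) (λ as → f (write (p ∷ ps) as ω))) ∎
  where
  open ≡-Reasoning
  Ω = vecs xs K

-- Resample the coordinates `p` and `q`. With the others frozen, at most one pair of values leads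
-- into `E`, so the event has probability at most `1 / V²` when `xs` has length `V`.
two-determined : {xs : List T} → Unique xs → {E : Pred (Vec T K) 0ℓ} (E? : Decidable E)
  (p q : Fin K) → p ≢ q →
  (∀ {ω ω′} → (∀ i → i ≢ p → i ≢ q → lookup ω i ≡ lookup ω′ i) → E ω → E ω′ →
     lookup ω p ≡ lookup ω′ p × lookup ω q ≡ lookup ω′ q) →
  length xs ^ 2 * ∑ (vecs xs K) (λ ω → ⟦ E? ω ⟧) ≤ length (vecs xs K)
two-determined {K = K} {xs = xs} u {E} E? p q p≢q det = begin
  length xs ^ 2 * ∑ Ω (λ ω → ⟦ E? ω ⟧)
    ≡⟨ resample xs (p ∷ q ∷ []) _ ⟩
  ∑ Ω (λ ω → ∑ (vecs xs 2) (λ as → ⟦ E? (write (p ∷ q ∷ []) as ω) ⟧))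
    ≡⟨ ∑-cong Ω (λ ω → trans (∑-vecs-suc xs _)
         (∑-cong xs (λ a → trans (∑-vecs-suc xs _) (∑-cong xs (λ b → +-identityʳ _))))) ⟩
  ∑ Ω (λ ω → ∑ xs (λ a → ∑ xs (λ b → ⟦ E? (upd ω a b) ⟧)))
    ≤⟨ ∑-mono Ω inner ⟩
  ∑ Ω (λ _ → 1)
    ≡⟨ ∑-length Ω ⟩
  length Ω ∎
  where
  open ≤-Reasoning
  Ω = vecs xs K
  upd : Vec _ K → _ → _ → Vec _ K
  upd ω a b = (ω [ q ]≔ b) [ p ]≔ a
  at-p : ∀ ω a b → lookup (upd ω a b) p ≡ a
  at-p ω a b = lookup∘update p (ω [ q ]≔ b) a
  at-q : ∀ ω a b → lookup (upd ω a b) q ≡ b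
  at-q ω a b = trans (lookup∘update′ (p≢q ∘ sym) (ω [ q ]≔ b) a) (lookup∘update q ω b)
  off : ∀ ω a b i → i ≢ p → i ≢ q → lookup (upd ω a b) i ≡ lookup ω i
  off ω a b i i≢p i≢q = trans (lookup∘update′ i≢p (ω [ q ]≔ b) a) (lookup∘update′ i≢q ω b)
  same : ∀ ω a b c d → E (upd ω a b) → E (upd ω c d) → a ≡ c × b ≡ d
  same ω a b c d e e′
    with det (λ i i≢p i≢q → trans (off ω a b i i≢p i≢q) (sym (off ω c d i i≢p i≢q))) e e′
  ... | eqp , eqq = trans (sym (at-p ω a b)) (trans eqp (at-p ω c d))
                  , trans (sym (at-q ω a b)) (trans eqq (at-q ω c d))
  inner : ∀ ω → ∑ xs (λ a → ∑ xs (λ b → ⟦ E? (upd ω a b) ⟧)) ≤ 1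
  inner ω = ∑-≤1 _ u
    (λ a → ∑-≤1 _ u (λ b → ⟦⟧≤1 (E? _))
             (λ {b} {d} x y → proj₂ (same ω a b a d (⟦⟧-pos (E? _) x) (⟦⟧-pos (E? _) y))))
    (λ {a} {c} x y → outer a c (∑-positive xs _ x) (∑-positive xs _ y))
    where
    outer : ∀ a c → ∃[ b ] (b ∈ xs × 0 < ⟦ E? (upd ω a b) ⟧) →
            ∃[ d ] (d ∈ xs × 0 < ⟦ E? (upd ω c d) ⟧) → a ≡ c
    outer a c (b , _ , x) (d , _ , y) =
      proj₁ (same ω a b c d (⟦⟧-pos (E? _) x) (⟦⟧-pos (E? _) y))

∈-vecs : {xs : List T} {v : Vec T n} → All (_∈ xs) v → v ∈ vecs xs n
∈-vecs []       = here refl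
∈-vecs (p ∷ ps) = ∈-cartesianProductWith⁺ _∷_ p (∈-vecs ps)

∈-vecs⁻ : {xs : List T} {v : Vec T n} → v ∈ vecs xs n → All (_∈ xs) v
∈-vecs⁻ {v = []} _ = []
∈-vecs⁻ {n = suc n} {xs = xs} {v = a ∷ v} p with ∈-cartesianProductWith⁻ _∷_ xs (vecs xs n) p
... | _ , _ , x∈ , v∈ , refl = x∈ ∷ ∈-vecs⁻ v∈

-- B_h[1]-sets

mult : ℕ → Vec ℕ n → ℕ
mult z []      = 0
mult z (x ∷ v) = ⟦ x ≟ z ⟧ + mult z v

mult≤length : ∀ z (v : Vec ℕ n) → mult z v ≤ n
mult≤length z []      = z≤n
mult≤length z (x ∷ v) = +-mono-≤ (⟦⟧≤1 (x ≟ z)) (mult≤length z v)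

-- Writing 0 instead of deleting keeps the length `n`; zeros change neither the sum nor the
-- multiplicities of positive numbers.
erase : ℕ → Vec ℕ n → Vec ℕ n
erase x []      = []
erase x (z ∷ v) with z ≟ x
... | yes _ = 0 ∷ erase x v
... | no  _ = z ∷ erase x v

sum-erase : ∀ x (v : Vec ℕ n) → sum v ≡ mult x v * x + sum (erase x v)
sum-erase x []      = refl
sum-erase x (z ∷ v) with z ≟ x
... | yes refl = trans (cong (z +_) (sum-erase x v)) (sym (+-assoc z _ _))
... | no  _    = begin
  z + sum v                              ≡⟨ cong (z +_) (sum-erase x v) ⟩
  z + (mult x v * x + sum (erase x v))   ≡⟨ +-assoc z _ _ ⟨
  z + mult x v * x + sum (erase x v)     ≡⟨ cong (_+ sum (erase x v)) (+-comm z _) ⟩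
  mult x v * x + z + sum (erase x v)     ≡⟨ +-assoc (mult x v * x) z _ ⟩
  mult x v * x + (z + sum (erase x v))   ∎
  where open ≡-Reasoning

mult-erase : ∀ {x z} → z ≢ x → 0 < z → (v : Vec ℕ n) → mult z (erase x v) ≡ mult z v
mult-erase         z≢x 0<z []      = refl
mult-erase {x = x} {z} z≢x 0<z (y ∷ v) with y ≟ x
... | no  _    = cong (⟦ y ≟ z ⟧ +_) (mult-erase z≢x 0<z v)
... | yes refl = cong₂ _+_
  (trans (⟦⟧-no (0 ≟ z) (<⇒≢ 0<z)) (sym (⟦⟧-no (y ≟ z) (z≢x ∘ sym))))
  (mult-erase z≢x 0<z v)

module _ {A : List ℕ} (0∈A : 0 ∈ A) where

  erase-∈ : ∀ x {v : Vec ℕ n} → All (_∈ x ∷ A) v → All (_∈ A) (erase x v)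
  erase-∈ x []                  = []
  erase-∈ x (_∷_ {x = z} p ps) with z ≟ x
  ... | yes _ = 0∈A ∷ erase-∈ x ps
  erase-∈ x (here z≡x ∷ ps) | no z≢x = ⊥-elim (z≢x z≡x)
  erase-∈ x (there p ∷ ps)  | no _   = p ∷ erase-∈ x ps

  -- One of the zeros put in place of x is dropped.
  erase-shorten : ∀ x {v : Vec ℕ (suc n)} → All (_∈ x ∷ A) v → 0 < mult x v →
                  ∃[ w ] (All (_∈ A) {n} w × sum w ≡ sum (erase x v))
  erase-shorten x {z ∷ v} (_ ∷ ps) 0<m with z ≟ x
  ... | yes _ = erase x v , erase-∈ x ps , refl
  erase-shorten {zero}  x {z ∷ []} (_ ∷ []) () | no _
  erase-shorten {suc n} x {z ∷ v} (here z≡x ∷ _) _ | no z≢x = ⊥-elim (z≢x z≡x)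
  erase-shorten {suc n} x {z ∷ v} (there p ∷ ps) 0<m | no _
    with erase-shorten x ps 0<m
  ... | w , w∈A , eq = z ∷ w , p ∷ w∈A , cong (z +_) eq

-- The B_h[1] property of A, with multiplicities in place of ordered tuples.  It
-- is used with 0 ∈ A, so that sums of fewer than h terms are included.
UniqueSums : ℕ → List ℕ → Set
UniqueSums h A = ∀ {p q : Vec ℕ h} → All (_∈ A) p → All (_∈ A) q → sum p ≡ sum q →
                 ∀ z → 0 < z → mult z p ≡ mult z q

-- These are the equations left over when the common copies of `x` are cancelled from two equal sums
-- of `h` terms. The side that keeps `c` copies of `x` has at most `h′` other terms; shorter sums
-- are padded with 0.
Fresh : ℕ → ℕ → List ℕ → Set
Fresh h′ x A = ∀ {c} {α : Vec ℕ h′} {β : Vec ℕ (suc h′)} → 0 < c → c ≤ suc h′ →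
               All (_∈ A) α → All (_∈ A) β → c * x + sum α ≢ sum β

-- Compare how often `x` occurs on the two sides. If the counts differ, cancelling the smaller one
-- gives an equation excluded by `Fresh`. If they agree, erasing `x` on both sides reduces to `A`.
UniqueSums-∷ : ∀ {h′ x A} → 0 ∈ A → UniqueSums (suc h′) A → Fresh h′ x A → UniqueSums (suc h′) (x ∷ A)
UniqueSums-∷ {h′} {x} {A} 0∈A uniq fresh {p} {q} p∈ q∈ eq z 0<z = go (<-cmp (mult x p) (mult x q))
  where
  split : ∀ {a b s t : ℕ} → a * x + s ≡ b * x + t → a ≤ b → (b ∸ a) * x + t ≡ s
  split {a} {b} {s} {t} e a≤b = +-cancelˡ-≡ (a * x) _ _ (begin
    a * x + ((b ∸ a) * x + t) ≡⟨ +-assoc (a * x) _ t ⟨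
    a * x + (b ∸ a) * x + t   ≡⟨ cong (_+ t) (*-distribʳ-+ x a (b ∸ a)) ⟨
    (a + (b ∸ a)) * x + t     ≡⟨ cong (λ m → m * x + t) (m+[n∸m]≡n a≤b) ⟩
    b * x + t                 ≡⟨ e ⟨
    a * x + s                 ∎)
    where open ≡-Reasoning

  clash : {u v : Vec ℕ (suc h′)} → All (_∈ x ∷ A) u → All (_∈ x ∷ A) v →
          sum u ≡ sum v → mult x u < mult x v → ⊥
  clash {u} {v} u∈ v∈ e lt with erase-shorten 0∈A x v∈ (≤-trans (s≤s z≤n) lt)
  ... | w , w∈ , sw = fresh (m<n⇒0<n∸m lt)
    (≤-trans (m∸n≤m (mult x v) (mult x u)) (mult≤length x v)) w∈ (erase-∈ 0∈A x u∈)
    (trans (cong ((mult x v ∸ mult x u) * x +_) sw)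
           (split (trans (sym (sum-erase x u)) (trans e (sum-erase x v))) (<⇒≤ lt)))

  go : _ → mult z p ≡ mult z q
  go (tri< lt _ _) = ⊥-elim (clash p∈ q∈ eq lt)
  go (tri> _ _ gt) = ⊥-elim (clash q∈ p∈ (sym eq) gt)
  go (tri≈ _ same _) with z ≟ x
  ... | yes refl = same
  ... | no z≢x   = begin
    mult z p           ≡⟨ mult-erase z≢x 0<z p ⟨
    mult z (erase x p) ≡⟨ uniq (erase-∈ 0∈A x p∈) (erase-∈ 0∈A x q∈) sums z 0<z ⟩
    mult z (erase x q) ≡⟨ mult-erase z≢x 0<z q ⟩
    mult z q           ∎
    where
    open ≡-Reasoning
    sums : sum (erase x p) ≡ sum (erase x q)
    sums = +-cancelˡ-≡ (mult x p * x) _ _ (begin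
      mult x p * x + sum (erase x p) ≡⟨ sum-erase x p ⟨
      sum p                          ≡⟨ eq ⟩
      sum q                          ≡⟨ sum-erase x q ⟩
      mult x q * x + sum (erase x q) ≡⟨ cong (λ m → m * x + sum (erase x q)) same ⟨
      mult x p * x + sum (erase x q) ∎)

mult-absent : ∀ {z} {v : Vec ℕ n} → All (z <_) v → mult z v ≡ 0
mult-absent []              = refl
mult-absent {z = z} (_∷_ {x = x} p ps) =
  cong₂ _+_ (⟦⟧-no (x ≟ z) (<⇒≢ p ∘ sym)) (mult-absent ps)

-- The heads are the minima. A strictly smaller head would be absent from the other vector, against
-- equal multiplicities.
sorted-≡ : {p q : Vec ℕ n} → All (0 <_) p → All (0 <_) q → Linked _≤_ p → Linked _≤_ q →
           (∀ z → 0 < z → mult z p ≡ mult z q) → p ≡ q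
sorted-≡ {p = []}    {[]}    _ _ _ _ _ = refl
sorted-≡ {p = a ∷ p} {b ∷ q} (0<a ∷ 0<p) (0<b ∷ 0<q) lp lq eq with <-cmp a b
... | tri< a<b _ _ = ⊥-elim (1+n≢0 (trans (cong (_+ mult a p) (sym (⟦⟧-yes (a ≟ a) refl)))
                       (trans (eq a 0<a) (mult-absent (Linked⇒All ≤-trans a<b lq)))))
... | tri> _ _ b<a = ⊥-elim (1+n≢0 (trans (cong (_+ mult b q) (sym (⟦⟧-yes (b ≟ b) refl)))
                       (trans (sym (eq b 0<b)) (mult-absent (Linked⇒All ≤-trans b<a lp)))))
... | tri≈ _ refl _ = cong (a ∷_) (sorted-≡ 0<p 0<q (Linked.tail lp) (Linked.tail lq)
                        (λ z 0<z → +-cancelˡ-≡ ⟦ a ≟ z ⟧ _ _ (eq z 0<z)))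

-- Linear equations in the sampled coordinates

-- A summand kept symbolic: a fixed number or a sampled coordinate. The list of possible equations
-- then does not depend on the sample, as a union bound requires.
Term : ℕ → Set
Term K = ℕ ⊎ Fin K

value : Vec ℕ K → Term K → ℕ
value ω (inj₁ a) = a
value ω (inj₂ i) = lookup ω i

total : Vec ℕ K → Vec (Term K) n → ℕ
total ω ts = sum (Vec.map (value ω) ts)

total-mono : (ts : Vec (Term K) n) → (∀ i → inj₂ i ∈ᵛ ts → lookup ω i ≤ lookup ω′ i) →
             total ω ts ≤ total ω′ ts
total-mono []            le = z≤n
total-mono (inj₁ a ∷ ts) le = +-monoʳ-≤ a (total-mono ts (λ i → le i ∘ VecAny.there))
total-mono (inj₂ i ∷ ts) le =
  +-mono-≤ (le i (VecAny.here refl)) (total-mono ts (λ j → le j ∘ VecAny.there))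

total-mono-< : (ts : Vec (Term K) n) {p : Fin K} →
               (∀ i → inj₂ i ∈ᵛ ts → lookup ω i ≤ lookup ω′ i) →
               inj₂ p ∈ᵛ ts → lookup ω p < lookup ω′ p → total ω ts < total ω′ ts
total-mono-< (inj₂ _ ∷ ts) le (VecAny.here refl) lt =
  +-mono-<-≤ lt (total-mono ts (λ j → le j ∘ VecAny.there))
total-mono-< (inj₁ a ∷ ts) le (VecAny.there p∈) lt =
  +-monoʳ-< a (total-mono-< ts (λ j → le j ∘ VecAny.there) p∈ lt)
total-mono-< (inj₂ i ∷ ts) le (VecAny.there p∈) lt =
  +-mono-≤-< (le i (VecAny.here refl)) (total-mono-< ts (λ j → le j ∘ VecAny.there) p∈ lt)

total-cong : (ts : Vec (Term K) n) → (∀ i → inj₂ i ∈ᵛ ts → lookup ω i ≡ lookup ω′ i) →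
             total ω ts ≡ total ω′ ts
total-cong ts eq = ≤-antisym (total-mono ts (λ i → ≤-reflexive ∘ eq i))
                             (total-mono ts (λ i → ≤-reflexive ∘ sym ∘ eq i))

-- `total` is strictly increasing in each coordinate that occurs; this replaces solving the equation
-- for the coordinate `p`.
total-determines : (ts : Vec (Term K) n) {p : Fin K} → inj₂ p ∈ᵛ ts →
                   (∀ i → inj₂ i ∈ᵛ ts → i ≢ p → lookup ω i ≡ lookup ω′ i) →
                   total ω ts ≡ total ω′ ts → lookup ω p ≡ lookup ω′ p
total-determines {ω = ω} {ω′ = ω′} ts {p} p∈ agree eq with <-cmp (lookup ω p) (lookup ω′ p)
... | tri≈ _ e _  = e
... | tri< lt _ _ = ⊥-elim (<-irrefl eq (total-mono-< ts le p∈ lt))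
  where
  le : ∀ i → inj₂ i ∈ᵛ ts → lookup ω i ≤ lookup ω′ i
  le i i∈ with i ≟ᶠ p
  ... | yes refl = <⇒≤ lt
  ... | no i≢p   = ≤-reflexive (agree i i∈ i≢p)
... | tri> _ _ gt = ⊥-elim (<-irrefl (sym eq) (total-mono-< ts ge p∈ gt))
  where
  ge : ∀ i → inj₂ i ∈ᵛ ts → lookup ω′ i ≤ lookup ω i
  ge i i∈ with i ≟ᶠ p
  ... | yes refl = <⇒≤ gt
  ... | no i≢p   = ≤-reflexive (sym (agree i i∈ i≢p))

tabulate-∈⁻ : ∀ {A : Set} {n} {f : Fin n → A} {x} → x ∈ᵛ tabulate f → ∃[ j ] (x ≡ f j)
tabulate-∈⁻ {n = suc n} (VecAny.here eq) = zero , eq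
tabulate-∈⁻ {n = suc n} (VecAny.there p) with tabulate-∈⁻ p
... | j , eq = suc j , eq

total-write : (ps : Fin n → Fin K) → (∀ {i j} → ps i ≡ ps j → i ≡ j) →
              (as : Vec ℕ n) (ω : Vec ℕ K) →
              total (write (tabulate ps) as ω) (tabulate (inj₂ ∘ ps)) ≡ sum as
total-write ps inj []       ω = refl
total-write ps inj (a ∷ as) ω = cong₂ _+_ (lookup∘update (ps zero) (write (tabulate (ps ∘ suc)) as ω) a)
  (trans (total-cong (tabulate (inj₂ ∘ ps ∘ suc)) keep)
         (total-write (ps ∘ suc) (suc-injectiveᶠ ∘ inj) as ω))
  where
  keep : ∀ i → inj₂ i ∈ᵛ tabulate (inj₂ ∘ ps ∘ suc) →
         lookup (write (tabulate (ps ∘ suc)) as ω [ ps zero ]≔ a) i ≡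
         lookup (write (tabulate (ps ∘ suc)) as ω) i
  keep i i∈ with tabulate-∈⁻ i∈
  ... | j , refl = lookup∘update′ ((λ ()) ∘ inj) (write (tabulate (ps ∘ suc)) as ω) a

-- Otherwise the positions of the `f l` in `ts` would inject `Fin m` into the smaller `Fin n`.
escape : ∀ {A : Set} (_≟ᴬ_ : (x y : A) → Dec (x ≡ y)) {f : Fin m → A} →
         (∀ {i j} → f i ≡ f j → i ≡ j) → n < m → (ts : Vec A n) → ∃[ l ] (f l ∉ᵛ ts)
escape _≟ᴬ_ {f} inj n<m ts with any? (λ l → ¬? (DecVec._∈?_ _≟ᴬ_ (f l) ts))
... | yes p = p
... | no ¬p = ⊥-elim (<⇒≢ᶠ i<j (inj (trans (VecAny.lookup-index (all i))
                (trans (cong (lookup ts) e) (sym (VecAny.lookup-index (all j)))))))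
  where
  all : ∀ l → f l ∈ᵛ ts
  all l = decidable-stable (DecVec._∈?_ _≟ᴬ_ (f l) ts) (λ ∉ → ¬p (l , ∉))
  ph = pigeonhole n<m (VecAny.index ∘ all)
  i = proj₁ ph
  j = proj₁ (proj₂ ph)
  i<j = proj₁ (proj₂ (proj₂ ph))
  e = proj₂ (proj₂ (proj₂ ph))

_≟ᵗ_ : (s t : Term K) → Dec (s ≡ t)
_≟ᵗ_ = ⊎-≡-dec _≟_ _≟ᶠ_

-- The coordinates come in m groups of k; a selection takes one from each group.
cell : Vec (Fin k) m → Fin m → Fin (m * k)
cell I j = combine j (lookup I j)

cell-injective : (I : Vec (Fin k) m) → ∀ {i j} → cell I i ≡ cell I j → i ≡ j
cell-injective I {i} {j} = combine-injectiveˡ i (lookup I i) j (lookup I j)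

addends : Vec (Fin k) m → Vec (Term (m * k)) m
addends I = tabulate (inj₂ ∘ cell I)

Represents : ℕ → Vec (Fin k) m → Vec ℕ (m * k) → Set
Represents u I ω = total ω (addends I) ≡ u

represents? : ∀ u (I : Vec (Fin k) m) ω → Dec (Represents u I ω)
represents? u I ω = total ω (addends I) ≟ u

cell∈addends : (I : Vec (Fin k) m) (j : Fin m) → inj₂ (cell I j) ∈ᵛ addends I
cell∈addends I j = ∈ᵛ-tabulate⁺ (inj₂ ∘ cell I) j

other∉addends : (I J : Vec (Fin k) m) (j : Fin m) → lookup I j ≢ lookup J j →
                inj₂ (cell J j) ∉ᵛ addends I
other∉addends I J j ne q∈ with tabulate-∈⁻ q∈
... | l , eq with inj₂-injective eq
...   | eq′ with combine-injectiveˡ j (lookup J j) l (lookup I l) eq′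
...     | refl = ne (sym (combine-injectiveʳ j (lookup J j) j (lookup I j) eq′))

-- Of the cells chosen in group `j`, that of `I` occurs only in the first equation and that of `J`
-- only in the second, so each equation fixes its own cell.
two-representations-determine : ∀ {u} (I J : Vec (Fin k) m) (j : Fin m) → lookup I j ≢ lookup J j →
  {ω ω′ : Vec ℕ (m * k)} →
  (∀ i → i ≢ cell I j → i ≢ cell J j → lookup ω i ≡ lookup ω′ i) →
  Represents u I ω × Represents u J ω → Represents u I ω′ × Represents u J ω′ →
  lookup ω (cell I j) ≡ lookup ω′ (cell I j) × lookup ω (cell J j) ≡ lookup ω′ (cell J j)
two-representations-determine I J j ne agree (rI , rJ) (rI′ , rJ′) =
  total-determines (addends I) (cell∈addends I j)
    (λ i i∈ i≢p → agree i i≢p (λ { refl → other∉addends I J j ne i∈ }))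
    (trans rI (sym rI′)) ,
  total-determines (addends J) (cell∈addends J j)
    (λ i i∈ i≢q → agree i (λ { refl → other∉addends J I j (ne ∘ sym) i∈ }) i≢q)
    (trans rJ (sym rJ′))

Equation : ℕ → ℕ → Set
Equation h′ K = ℕ × Vec (Term K) h′ × Vec (Term K) (suc h′)

-- What is excluded from `α` and `β` is the coordinate `i`, not its value. Two coordinates with
-- equal values thus clash through `x = y`, once 0 is available as padding.
Clash : ∀ {h′} → Vec ℕ K → Fin K → Equation h′ K → Set
Clash ω i (c , α , β) =
  inj₂ i ∉ᵛ α × inj₂ i ∉ᵛ β × c * lookup ω i + total ω α ≡ total ω β

clash? : ∀ {h′} (ω : Vec ℕ K) i (e : Equation h′ K) → Dec (Clash ω i e)
clash? ω i (c , α , β) =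
  ¬? (DecVec._∈?_ _≟ᵗ_ (inj₂ i) α) ×-dec ¬? (DecVec._∈?_ _≟ᵗ_ (inj₂ i) β) ×-dec
  (c * lookup ω i + total ω α ≟ total ω β)

-- In the pair of equations the coordinates p = cell I j and q = cell I l have
-- the coefficient vectors (1, 1) and (c, −b) with c > 0 and b ≥ 0, which are
-- linearly independent.
clash-determines : ∀ {h′ u c} (I : Vec (Fin k) m) (j l : Fin m)
  (α : Vec (Term (m * k)) h′) (β : Vec (Term (m * k)) (suc h′)) → 0 < c →
  inj₂ (cell I l) ∉ᵛ α → {ω ω′ : Vec ℕ (m * k)} →
  (∀ i → i ≢ cell I j → i ≢ cell I l → lookup ω i ≡ lookup ω′ i) →
  Represents u I ω × Clash ω (cell I j) (c , α , β) →
  Represents u I ω′ × Clash ω′ (cell I j) (c , α , β) →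
  lookup ω (cell I j) ≡ lookup ω′ (cell I j) × lookup ω (cell I l) ≡ lookup ω′ (cell I l)
clash-determines {k = k} {m = m} {u = u} {c} I j l α β 0<c q∉α {ω₁} {ω₂} agree₁₂ (r₁ , cl₁) (r₂ , cl₂) = eqp , eqq
  where
  p = cell I j
  q = cell I l
  Agree : Vec ℕ (m * k) → Vec ℕ (m * k) → Set
  Agree ω ω′ = ∀ i → i ≢ p → i ≢ q → lookup ω i ≡ lookup ω′ i
  -- If the value at `p` grew, the left side of the clash equation would grow, hence `β`, and hence
  -- the value at `q`, the only coordinate in `β` that can change. Then the sum over `addends I`
  -- would grow, although it equals `u` both times.
  ¬< : ∀ {ω ω′} → Agree ω ω′ → Represents u I ω → Represents u I ω′ →
       Clash ω p (c , α , β) → Clash ω′ p (c , α , β) → ¬ (lookup ω p < lookup ω′ p)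
  ¬< {ω} {ω′} agree r r′ (p∉α , p∉β , e) (_ , _ , e′) lt =
    <-irrefl (trans r (sym r′)) (total-mono-< (addends I) le (cell∈addends I j) lt)
    where
    α≡ : total ω α ≡ total ω′ α
    α≡ = total-cong α (λ i i∈ → agree i (λ { refl → p∉α i∈ }) (λ { refl → q∉α i∈ }))
    β< : total ω β < total ω′ β
    β< = subst₂ _<_ (trans (cong (c * lookup ω p +_) (sym α≡)) e) e′
           (+-monoˡ-< (total ω′ α) (*-monoʳ-< c {{>-nonZero 0<c}} lt))
    q< : lookup ω q < lookup ω′ q
    q< = ≰⇒> (λ q≥ → <⇒≱ β< (total-mono β (ge q≥)))
      where
      ge : lookup ω′ q ≤ lookup ω q → ∀ i → inj₂ i ∈ᵛ β → lookup ω′ i ≤ lookup ω i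
      ge q≥ i i∈ with i ≟ᶠ q
      ... | yes refl = q≥
      ... | no i≢q = ≤-reflexive (sym (agree i (λ { refl → p∉β i∈ }) i≢q))
    le : ∀ i → inj₂ i ∈ᵛ addends I → lookup ω i ≤ lookup ω′ i
    le i _ with i ≟ᶠ p | i ≟ᶠ q
    ... | yes refl | _ = <⇒≤ lt
    ... | no _ | yes refl = <⇒≤ q<
    ... | no i≢p | no i≢q = ≤-reflexive (agree i i≢p i≢q)
  eqp : lookup ω₁ p ≡ lookup ω₂ p
  eqp = ≤-antisym (≮⇒≥ (¬< (λ i a b → sym (agree₁₂ i a b)) r₂ r₁ cl₂ cl₁))
                  (≮⇒≥ (¬< agree₁₂ r₁ r₂ cl₁ cl₂))
  eqq : lookup ω₁ q ≡ lookup ω₂ q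
  eqq = total-determines (addends I) (cell∈addends I l) agree′ (trans r₁ (sym r₂))
    where
    agree′ : ∀ i → inj₂ i ∈ᵛ addends I → i ≢ q → lookup ω₁ i ≡ lookup ω₂ i
    agree′ i _ i≢q with i ≟ᶠ p
    ... | yes refl = eqp
    ... | no i≢p = agree₁₂ i i≢p i≢q

-- Counting inequalities and sums of numbers from an interval

⟦⟧-mono : (d : Dec Φ) (e : Dec Ψ) → (Φ → Ψ) → ⟦ d ⟧ ≤ ⟦ e ⟧
⟦⟧-mono (no _)  e f = z≤n
⟦⟧-mono (yes p) e f = ≤-reflexive (sym (⟦⟧-yes e (f p)))

⟦⟧≤ : ∀ {n} (d : Dec Φ) → (Φ → 1 ≤ n) → ⟦ d ⟧ ≤ n
⟦⟧≤ (yes p) f = f p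
⟦⟧≤ (no _)  f = z≤n

∑-≥-const : (xs : List T) {f : T → ℕ} {c : ℕ} → (∀ {x} → x ∈ xs → c ≤ f x) → length xs * c ≤ ∑ xs f
∑-≥-const xs {c = c} h = ≤-trans (≤-reflexive (sym (∑-const xs c))) (∑-mono-∈ xs h)

∑∑-≤ : (Ω : List T″) (xs : List T) (f : T → T″ → ℕ) {v c : ℕ} →
       (∀ {x} → x ∈ xs → v * ∑ Ω (f x) ≤ c) →
       v * ∑ Ω (λ ω → ∑ xs (λ x → f x ω)) ≤ length xs * c
∑∑-≤ Ω xs f {v} {c} le = begin
  v * ∑ Ω (λ ω → ∑ xs (λ x → f x ω)) ≡⟨ cong (v *_) (∑-comm Ω xs (λ ω x → f x ω)) ⟩
  v * ∑ xs (λ x → ∑ Ω (f x))         ≡⟨ *-distribˡ-∑ xs v _ ⟩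
  ∑ xs (λ x → v * ∑ Ω (f x))         ≤⟨ ∑-≤-const xs le ⟩
  length xs * c                      ∎
  where open ≤-Reasoning

∑∑-≥ : (Ω : List T″) (xs : List T) (f : T → T″ → ℕ) {v c : ℕ} →
       (∀ {x} → x ∈ xs → c ≤ v * ∑ Ω (f x)) →
       length xs * c ≤ v * ∑ Ω (λ ω → ∑ xs (λ x → f x ω))
∑∑-≥ Ω xs f {v} {c} le = begin
  length xs * c                      ≤⟨ ∑-≥-const xs le ⟩
  ∑ xs (λ x → v * ∑ Ω (f x))         ≡⟨ *-distribˡ-∑ xs v _ ⟨
  v * ∑ xs (λ x → ∑ Ω (f x))         ≡⟨ cong (v *_) (∑-comm Ω xs (λ ω x → f x ω)) ⟨
  v * ∑ Ω (λ ω → ∑ xs (λ x → f x ω)) ∎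
  where open ≤-Reasoning

length-cartesianProduct : (xs : List T) (ys : List T″) →
                          length (cartesianProduct xs ys) ≡ length xs * length ys
length-cartesianProduct xs ys = begin
  length (cartesianProduct xs ys)         ≡⟨ ∑-length (cartesianProduct xs ys) ⟨
  ∑ (cartesianProduct xs ys) (λ _ → 1)    ≡⟨ ∑-cartesianProductWith _,_ xs ys _ ⟩
  ∑ xs (λ _ → ∑ ys (λ _ → 1))             ≡⟨ ∑-const xs _ ⟩
  length xs * ∑ ys (λ _ → 1)              ≡⟨ cong (length xs *_) (∑-length ys) ⟩
  length xs * length ys                   ∎
  where open ≡-Reasoning

vecs-unique : {xs : List T} → Unique xs → ∀ n → Unique (vecs xs n)
vecs-unique u zero    = ListAll.[] ∷ []
vecs-unique u (suc n) = Unique.cartesianProductWith⁺ _∷_ ∷-injective u (vecs-unique u n)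

∑-applyUpTo-mono : (g : ℕ → T) (f : T → ℕ) {m n : ℕ} → m ≤ n →
                   ∑ (applyUpTo g m) f ≤ ∑ (applyUpTo g n) f
∑-applyUpTo-mono g f z≤n       = z≤n
∑-applyUpTo-mono g f (s≤s m≤n) = +-monoʳ-≤ (f (g 0)) (∑-applyUpTo-mono (g ∘ suc) f m≤n)

-- Take the first n terms from [B, B + ℓ); the last one is then forced and lies
-- in the window.
sums-lower-bound : ∀ {B V ℓ} → ℓ ≤ V → ∀ n {u} → suc n * B + n * ℓ ≤ u → u < suc n * B + V →
                   ℓ ^ n ≤ ∑ (vecs (applyUpTo (B +_) V) (suc n)) (λ a → ⟦ sum a ≟ u ⟧)
sums-lower-bound {B} {V} ℓ≤V zero {u} lo hi = begin
  1                                      ≡⟨ ⟦⟧-yes (sum (u ∷ []) ≟ u) (+-identityʳ u) ⟨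
  ⟦ sum (u ∷ []) ≟ u ⟧                   ≤⟨ term≤∑ (λ a → ⟦ sum a ≟ u ⟧) (∈-vecs (u∈ ∷ [])) ⟩
  ∑ (vecs (applyUpTo (B +_) V) 1) (λ a → ⟦ sum a ≟ u ⟧) ∎
  where
  open ≤-Reasoning
  B≤u : B ≤ u
  B≤u = ≤-trans (≤-reflexive (sym (trans (+-identityʳ _) (+-identityʳ B)))) lo
  u∈ : u ∈ applyUpTo (B +_) V
  u∈ = subst (_∈ applyUpTo (B +_) V) (m+[n∸m]≡n B≤u)
    (∈-applyUpTo⁺ (B +_) (+-cancelˡ-< B _ _
      (subst₂ _<_ (sym (m+[n∸m]≡n B≤u)) (cong (_+ V) (+-identityʳ B)) hi)))
sums-lower-bound {B} {V} {ℓ} ℓ≤V (suc n) {u} lo hi = begin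
  ℓ * ℓ ^ n                                      ≡⟨ cong (_* ℓ ^ n) (length-applyUpTo (B +_) ℓ) ⟨
  length (applyUpTo (B +_) ℓ) * ℓ ^ n            ≤⟨ ∑-≥-const (applyUpTo (B +_) ℓ) first ⟩
  ∑ (applyUpTo (B +_) ℓ) (λ x → ∑ rest (λ a → ⟦ sum (x ∷ a) ≟ u ⟧))
    ≤⟨ ∑-applyUpTo-mono (B +_) _ ℓ≤V ⟩
  ∑ (applyUpTo (B +_) V) (λ x → ∑ rest (λ a → ⟦ sum (x ∷ a) ≟ u ⟧))
    ≡⟨ ∑-vecs-suc (applyUpTo (B +_) V) _ ⟨
  ∑ (vecs (applyUpTo (B +_) V) (suc (suc n))) (λ a → ⟦ sum a ≟ u ⟧) ∎
  where
  open ≤-Reasoning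
  rest = vecs (applyUpTo (B +_) V) (suc n)
  first : ∀ {x} → x ∈ applyUpTo (B +_) ℓ → ℓ ^ n ≤ ∑ rest (λ a → ⟦ sum (x ∷ a) ≟ u ⟧)
  first {x} x∈ with ∈-applyUpTo⁻ (B +_) x∈
  ... | y , y<ℓ , refl = ≤-trans (sums-lower-bound ℓ≤V n lo′ hi′)
      (∑-mono rest (λ a → ⟦⟧-mono (sum a ≟ u ∸ x) (x + sum a ≟ u)
        (λ e → trans (cong (x +_) e) (m+[n∸m]≡n x≤u))))
    where
    low : x + (suc n * B + n * ℓ) ≤ u
    low = begin
      B + y + (suc n * B + n * ℓ)   ≤⟨ +-monoˡ-≤ _ (+-monoʳ-≤ B (<⇒≤ y<ℓ)) ⟩
      B + ℓ + (suc n * B + n * ℓ)   ≡⟨ solve 4 (λ b l s t → b :+ l :+ (s :+ t) := b :+ s :+ (l :+ t)) refl B ℓ (suc n * B) (n * ℓ) ⟩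
      B + suc n * B + (ℓ + n * ℓ)   ≤⟨ lo ⟩
      u                             ∎
    x≤u : x ≤ u
    x≤u = ≤-trans (m≤m+n x _) low
    lo′ : suc n * B + n * ℓ ≤ u ∸ x
    lo′ = +-cancelˡ-≤ x _ _ (subst (x + (suc n * B + n * ℓ) ≤_) (sym (m+[n∸m]≡n x≤u)) low)
    hi′ : u ∸ x < suc n * B + V
    hi′ = +-cancelˡ-< x _ _ (begin-strict
      x + (u ∸ x)             ≡⟨ m+[n∸m]≡n x≤u ⟩
      u                       <⟨ hi ⟩
      B + suc n * B + V       ≡⟨ +-assoc B _ V ⟩
      B + (suc n * B + V)     ≤⟨ +-monoˡ-≤ _ (m≤m+n B y) ⟩
      x + (suc n * B + V)     ∎)

^-distribʳ-* : ∀ n a b → (a * b) ^ n ≡ a ^ n * b ^ n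
^-distribʳ-* zero    a b = refl
^-distribʳ-* (suc n) a b = trans (cong (a * b *_) (^-distribʳ-* n a b))
  (solve 4 (λ a b x y → a :* b :* (x :* y) := a :* x :* (b :* y)) refl a b (a ^ n) (b ^ n))

lookup-ext : (v w : Vec T n) → (∀ i → lookup v i ≡ lookup w i) → v ≡ w
lookup-ext []      []      _ = refl
lookup-ext (_ ∷ v) (_ ∷ w) f = cong₂ _∷_ (f zero) (lookup-ext v w (f ∘ suc))

-- Expected coverage

module Sampling (h′ k B V : ℕ) (A : List ℕ) where

  -- `H = 2h`, and `H′ = 2h − 1` counts both the free terms of a representation and the terms of `α`
  -- and `β` together.
  h H H′ N : ℕ
  h  = suc h′
  H′ = h′ + h
  H  = suc H′
  N  = H * k

  window : List ℕ
  window = applyUpTo (B +_) V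

  length-window : length window ≡ V
  length-window = length-applyUpTo (B +_) V

  window-unique : Unique window
  window-unique = Unique.applyUpTo⁺₁ (B +_) V (λ i<j _ e → <⇒≢ i<j (+-cancelˡ-≡ B _ _ e))

  Ω : List (Vec ℕ N)
  Ω = vecs window N

  selections : List (Vec (Fin k) H)
  selections = vecs (allFin k) H

  terms : List (Term N)
  terms = map inj₁ A ++ map inj₂ (allFin N)

  equations : List (Equation h′ N)
  equations = cartesianProduct (map (1 +_) (upTo h)) (cartesianProduct (vecs terms h′) (vecs terms h))

  Clashing : Vec ℕ N → Fin N → Set
  Clashing ω i = Any (Clash ω i) equations

  clashing? : ∀ ω i → Dec (Clashing ω i)
  clashing? ω i = Any.any? (clash? ω i) equations

  RepresentedBy : ℕ → Vec ℕ N → Vec (Fin k) H → Set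
  RepresentedBy u ω I = Represents u I ω × (∀ j → ¬ Clashing ω (cell I j))

  Represented : ℕ → Vec ℕ N → Set
  Represented u ω = Any (RepresentedBy u ω) selections

  represented? : ∀ u ω → Dec (Represented u ω)
  represented? u ω = Any.any? (λ I → represents? u I ω ×-dec all? (λ j → ¬? (clashing? ω (cell I j)))) selections

  Spoiled : ℕ → Vec (Fin k) H → Fin H → Equation h′ N → Vec ℕ N → Set
  Spoiled u I j e ω = Represents u I ω × Clash ω (cell I j) e

  spoiled? : ∀ u I j e ω → Dec (Spoiled u I j e ω)
  spoiled? u I j e ω = represents? u I ω ×-dec clash? ω (cell I j) e

  Double : ℕ → Vec (Fin k) H → Vec (Fin k) H → Vec ℕ N → Set
  Double u I J ω = I ≢ J × Represents u I ω × Represents u J ω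

  double? : ∀ u I J ω → Dec (Double u I J ω)
  double? u I J ω = ¬? (≡-dec _≟ᶠ_ I J) ×-dec represents? u I ω ×-dec represents? u J ω

  #rep #spoiled #double : ℕ → Vec ℕ N → ℕ
  #rep u ω = ∑[ I ∈ selections ] ⟦ represents? u I ω ⟧
  #spoiled u ω = ∑[ I ∈ selections ] ∑[ j ∈ allFin H ] ∑[ e ∈ equations ] ⟦ spoiled? u I j e ω ⟧
  #double u ω = ∑[ I ∈ selections ] ∑[ J ∈ selections ] ⟦ double? u I J ω ⟧

  -- Fix one representing selection `I`; every other representing `J` contributes the pair `(I, J)`
  -- to `#double`.
  #rep≤1+#double : ∀ u ω → #rep u ω ≤ 1 + #double u ω
  #rep≤1+#double u ω with #rep u ω in eq
  ... | zero  = z≤n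
  ... | suc r with ∑-positive selections _ (subst (0 <_) (sym eq) (s≤s z≤n))
  ...   | I , I∈ , 0<I = begin
    suc r                                                ≡⟨ eq ⟨
    ∑ selections (λ J → ⟦ represents? u J ω ⟧)           ≤⟨ ∑-mono selections compare ⟩
    ∑ selections (λ J → ⟦ ≡-dec _≟ᶠ_ I J ⟧ + ⟦ double? u I J ω ⟧)
      ≡⟨ ∑-distrib-+ selections _ _ ⟩
    ∑ selections (λ J → ⟦ ≡-dec _≟ᶠ_ I J ⟧) + ∑ selections (λ J → ⟦ double? u I J ω ⟧)
      ≤⟨ +-mono-≤ (∑-≤1 _ (vecs-unique (Unique.allFin⁺ k) H) (λ J → ⟦⟧≤1 (≡-dec _≟ᶠ_ I J))
                     (λ p q → trans (sym (⟦⟧-pos (≡-dec _≟ᶠ_ I _) p)) (⟦⟧-pos (≡-dec _≟ᶠ_ I _) q)))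
                  (term≤∑ (λ I → ∑ selections (λ J → ⟦ double? u I J ω ⟧)) I∈) ⟩
    1 + #double u ω ∎
    where
    open ≤-Reasoning
    compare : ∀ J → ⟦ represents? u J ω ⟧ ≤ ⟦ ≡-dec _≟ᶠ_ I J ⟧ + ⟦ double? u I J ω ⟧
    compare J with ≡-dec _≟ᶠ_ I J
    ... | yes eq = ≤-trans (⟦⟧≤1 (represents? u J ω)) (m≤m+n 1 _)
    ... | no ne  = ⟦⟧-mono (represents? u J ω) (¬? (no ne) ×-dec represents? u I ω ×-dec represents? u J ω)
                    (λ r → ne , ⟦⟧-pos (represents? u I ω) 0<I , r)

  -- A union bound if u is not represented, a Bonferroni inequality if it is.
  #rep≤ : ∀ u ω → #rep u ω ≤ ⟦ represented? u ω ⟧ + (#spoiled u ω + #double u ω)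
  #rep≤ u ω with represented? u ω
  ... | yes _ = ≤-trans (#rep≤1+#double u ω) (+-monoʳ-≤ 1 (m≤n+m _ _))
  ... | no ¬r = ≤-trans (∑-mono-∈ selections spoil) (m≤m+n _ _)
    where
    open ≤-Reasoning
    spoil : ∀ {I} → I ∈ selections →
            ⟦ represents? u I ω ⟧ ≤ ∑ (allFin H) (λ j → ∑ equations (λ e → ⟦ spoiled? u I j e ω ⟧))
    spoil {I} I∈ = ⟦⟧≤ (represents? u I ω) (λ r → hit r (¬∀⟶∃¬ H (λ j → ¬ Clashing ω (cell I j))
      (λ j → ¬? (clashing? ω (cell I j))) (λ good → ¬r (lose I∈ (r , good)))))
      where
      hit : Represents u I ω → ∃[ j ] ¬ ¬ Clashing ω (cell I j) →
            1 ≤ ∑ (allFin H) (λ j → ∑ equations (λ e → ⟦ spoiled? u I j e ω ⟧))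
      hit r (j , ¬¬cl) with find (decidable-stable (clashing? ω (cell I j)) ¬¬cl)
      ... | e , e∈ , cl = begin
        1                                               ≡⟨ ⟦⟧-yes (spoiled? u I j e ω) (r , cl) ⟨
        ⟦ spoiled? u I j e ω ⟧                          ≤⟨ term≤∑ (λ e → ⟦ spoiled? u I j e ω ⟧) e∈ ⟩
        ∑ equations (λ e → ⟦ spoiled? u I j e ω ⟧)
          ≤⟨ term≤∑ (λ j → ∑ equations (λ e → ⟦ spoiled? u I j e ω ⟧)) (∈-allFin j) ⟩
        ∑ (allFin H) (λ j → ∑ equations (λ e → ⟦ spoiled? u I j e ω ⟧)) ∎

  length-Ω : length Ω ≡ V ^ N
  length-Ω = trans (length-vecs window N) (cong (_^ N) length-window)

  length-selections : length selections ≡ k ^ H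
  length-selections = trans (length-vecs (allFin k) H) (cong (_^ H) (length-tabulate {n = k} (λ i → i)))

  length-terms : length terms ≡ length A + N
  length-terms = trans (length-++ (map inj₁ A)) (cong₂ _+_ (length-map inj₁ A)
    (trans (length-map inj₂ (allFin N)) (length-tabulate (λ i → i))))

  length-equations : length equations ≡ h * (length A + N) ^ H′
  length-equations = begin
    length equations
      ≡⟨ length-cartesianProduct (map (1 +_) (upTo h)) (cartesianProduct (vecs terms h′) (vecs terms h)) ⟩
    length (map (1 +_) (upTo h)) * length (cartesianProduct (vecs terms h′) (vecs terms h))
      ≡⟨ cong₂ _*_ (trans (length-map (1 +_) (upTo h)) (length-upTo h)) (length-cartesianProduct (vecs terms h′) (vecs terms h)) ⟩
    h * (length (vecs terms h′) * length (vecs terms h))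
      ≡⟨ cong (h *_) (cong₂ _*_ (length-vecs terms h′) (length-vecs terms h)) ⟩
    h * (length terms ^ h′ * length terms ^ h)
      ≡⟨ cong (h *_) (^-distribˡ-+-* (length terms) h′ h) ⟨
    h * length terms ^ H′
      ≡⟨ cong (λ t → h * t ^ H′) length-terms ⟩
    h * (length A + N) ^ H′ ∎
    where open ≡-Reasoning

  equation-positive : ∀ {c α β} → (c , α , β) ∈ equations → 0 < c
  equation-positive e∈ with ∈-map⁻ (1 +_) (proj₁ (∈-cartesianProduct⁻ (map (1 +_) (upTo h)) _ e∈))
  ... | _ , _ , refl = s≤s z≤n

  -- The 2h cells of I cannot all be among cell I j and the h − 1 terms of α.
  spoiled-bound : ∀ u I j {e} → e ∈ equations →
                  V ^ 2 * ∑ Ω (λ ω → ⟦ spoiled? u I j e ω ⟧) ≤ length Ω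
  spoiled-bound u I j {e@(c , α , β)} e∈
    with escape _≟ᵗ_ (λ e → cell-injective I (inj₂-injective e)) (s≤s (m<m+n h′ (s≤s z≤n))) (inj₂ (cell I j) ∷ α)
  ... | l , l∉ = subst (λ v → v ^ 2 * ∑ Ω (λ ω → ⟦ spoiled? u I j e ω ⟧) ≤ length Ω) length-window
    (two-determined window-unique (spoiled? u I j e) (cell I j) (cell I l)
      (λ eq → l∉ (VecAny.here (cong inj₂ (sym eq))))
      (clash-determines I j l α β (equation-positive e∈) (l∉ ∘ VecAny.there)))

  -- Distinct selections differ in some group, and their two cells there are determined by the
  -- remaining coordinates.
  double-bound : ∀ u I J → V ^ 2 * ∑ Ω (λ ω → ⟦ double? u I J ω ⟧) ≤ length Ω
  double-bound u I J = go (≡-dec _≟ᶠ_ I J)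
    where
    S = ∑ Ω (λ ω → ⟦ double? u I J ω ⟧)
    go : Dec (I ≡ J) → V ^ 2 * S ≤ length Ω
    go (yes eq) = subst (_≤ length Ω) (sym (trans (cong (V ^ 2 *_) S≡0) (*-zeroʳ (V ^ 2)))) z≤n
      where
      S≡0 : S ≡ 0
      S≡0 = trans (∑-cong Ω {g = λ _ → 0} (λ ω → ⟦⟧-no (double? u I J ω) (λ p → proj₁ p eq)))
                  (trans (∑-const Ω 0) (*-zeroʳ (length Ω)))
    go (no ne) with ¬∀⟶∃¬ H (λ j → lookup I j ≡ lookup J j) (λ j → lookup I j ≟ᶠ lookup J j) (ne ∘ lookup-ext I J)
    ... | j , nej = subst (λ v → v ^ 2 * S ≤ length Ω) length-window
      (two-determined window-unique (double? u I J) (cell I j) (cell J j)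
        (λ eq → nej (combine-injectiveʳ j (lookup I j) j (lookup J j) eq))
        (λ agree e e′ → two-representations-determine I J j nej agree (proj₂ e) (proj₂ e′)))

  module _ {ℓ Z : ℕ} (0<ℓ : 0 < ℓ) (V≡Zℓ : V ≡ Z * ℓ) (ℓ≤V : ℓ ≤ V) where

    -- Resample the `H` cells of `I`: whatever the other coordinates are, at least `ℓ ^ H′` of the
    -- `V ^ H` choices sum to `u`. Since `V = Zℓ`, this is a proportion of at least `1 / (V Z^H′)`.
    represents-bound : ∀ {u} → H * B + H′ * ℓ ≤ u → u < H * B + V → ∀ I →
                       length Ω ≤ V * Z ^ H′ * ∑ Ω (λ ω → ⟦ represents? u I ω ⟧)
    represents-bound {u} lo hi I = *-cancelˡ-≤ (ℓ ^ H′) {{m^n≢0 ℓ H′ {{>-nonZero 0<ℓ}}}} (begin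
      ℓ ^ H′ * length Ω
        ≡⟨ *-comm (ℓ ^ H′) _ ⟩
      length Ω * ℓ ^ H′
        ≤⟨ ∑-≥-const Ω (λ _ → sums-lower-bound ℓ≤V H′ lo hi) ⟩
      ∑ Ω (λ ω → ∑ (vecs window H) (λ a → ⟦ sum a ≟ u ⟧))
        ≡⟨ ∑-cong Ω (λ ω → ∑-cong (vecs window H) (λ a → cong (λ s → ⟦ s ≟ u ⟧)
             (total-write (cell I) (cell-injective I) a ω))) ⟨
      ∑ Ω (λ ω → ∑ (vecs window H) (λ a → ⟦ represents? u I (write (tabulate (cell I)) a ω) ⟧))
        ≡⟨ resample window (tabulate (cell I)) (λ ω → ⟦ represents? u I ω ⟧) ⟨
      length window ^ H * S
        ≡⟨ cong (λ v → v ^ H * S) length-window ⟩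
      V * V ^ H′ * S
        ≡⟨ cong (λ v → V * v ^ H′ * S) V≡Zℓ ⟩
      V * (Z * ℓ) ^ H′ * S
        ≡⟨ cong (λ v → V * v * S) (^-distribʳ-* H′ Z ℓ) ⟩
      V * (Z ^ H′ * ℓ ^ H′) * S
        ≡⟨ solve 4 (λ v z l s → v :* (z :* l) :* s := l :* (v :* z :* s)) refl V (Z ^ H′) (ℓ ^ H′) S ⟩
      ℓ ^ H′ * (V * Z ^ H′ * S) ∎)
      where
      open ≤-Reasoning
      S = ∑ Ω (λ ω → ⟦ represents? u I ω ⟧)

    -- By `#rep≤`, the probability of being represented is at least the expected number of
    -- representations, `k^H / (V Z^H′)` or more, minus the expected numbers of spoiled and double
    -- ones. Those cost at most `k^H (H E + k^H) / V²`, with `E` the number of equations, which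
    -- `small` makes at most half of the main term.
    expected-representation : ∀ {u} → H * B + H′ * ℓ ≤ u → u < H * B + V →
      2 * Z ^ H′ * (H * (h * (length A + N) ^ H′) + k ^ H) ≤ V →
      k ^ H * length Ω ≤ 2 * (V * Z ^ H′) * ∑ Ω (λ ω → ⟦ represented? u ω ⟧)
    expected-representation {u} lo hi small =
      -- The main inequality is taken twice, so that one copy of `V * (s * W)` remains after the
      -- other has absorbed the error terms.
      *-cancelˡ-≤ V {{>-nonZero (<-≤-trans 0<ℓ ℓ≤V)}} (+-cancelʳ-≤ (V * (s * W)) _ _ (begin
        V * (s * W) + V * (s * W)
          ≤⟨ +-mono-≤ main main ⟩
        V * (V * ζ * (Sc + (Sb + Sd))) + V * (V * ζ * (Sc + (Sb + Sd)))
          ≡⟨ solve 5 (λ v c x y z → v :* (v :* c :* (x :+ (y :+ z))) :+ v :* (v :* c :* (x :+ (y :+ z)))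
                := v :* (con 2 :* (v :* c) :* x) :+ con 2 :* c :* (v :* (v :* con 1) :* y :+ v :* (v :* con 1) :* z)) refl V ζ Sc Sb Sd ⟩
        V * (2 * (V * ζ) * Sc) + 2 * ζ * (V ^ 2 * Sb + V ^ 2 * Sd)
          ≤⟨ +-monoʳ-≤ (V * (2 * (V * ζ) * Sc)) (*-monoʳ-≤ (2 * ζ) (+-mono-≤ bad dbl)) ⟩
        V * (2 * (V * ζ) * Sc) + 2 * ζ * (s * (H * (E * W)) + s * (s * W))
          ≡⟨ cong (V * (2 * (V * ζ) * Sc) +_) (solve 5 (λ c s h e w → con 2 :* c :* (s :* (h :* (e :* w)) :+ s :* (s :* w))
                := con 2 :* c :* (h :* e :+ s) :* (s :* w)) refl ζ s H E W) ⟩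
        V * (2 * (V * ζ) * Sc) + 2 * ζ * (H * E + s) * (s * W)
          ≤⟨ +-monoʳ-≤ (V * (2 * (V * ζ) * Sc)) (*-monoˡ-≤ (s * W) small) ⟩
        V * (2 * (V * ζ) * Sc) + V * (s * W) ∎))
      where
      open ≤-Reasoning
      ζ = Z ^ H′
      s = k ^ H
      W = length Ω
      E = h * (length A + N) ^ H′
      Sc = ∑ Ω (λ ω → ⟦ represented? u ω ⟧)
      Sb = ∑ Ω (#spoiled u)
      Sd = ∑ Ω (#double u)
      main : V * (s * W) ≤ V * (V * ζ * (Sc + (Sb + Sd)))
      main = *-monoʳ-≤ V (begin
        s * W
          ≡⟨ cong (_* W) length-selections ⟨
        length selections * W
          ≤⟨ ∑∑-≥ Ω selections (λ I ω → ⟦ represents? u I ω ⟧) {v = V * ζ} (λ {I} _ → represents-bound lo hi I) ⟩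
        V * ζ * ∑ Ω (#rep u)
          ≤⟨ *-monoʳ-≤ (V * ζ) (∑-mono Ω (#rep≤ u)) ⟩
        V * ζ * ∑ Ω (λ ω → ⟦ represented? u ω ⟧ + (#spoiled u ω + #double u ω))
          ≡⟨ cong (V * ζ *_) (trans (∑-distrib-+ Ω _ _) (cong (Sc +_) (∑-distrib-+ Ω _ _))) ⟩
        V * ζ * (Sc + (Sb + Sd)) ∎)
      bad : V ^ 2 * Sb ≤ s * (H * (E * W))
      bad = subst₂ (λ a b → V ^ 2 * Sb ≤ a * (b * (E * W))) length-selections (length-tabulate {n = H} (λ i → i))
        (subst (λ e → V ^ 2 * Sb ≤ length selections * (length (allFin H) * (e * W))) length-equations
        (∑∑-≤ Ω selections (λ I ω → ∑ (allFin H) (λ j → ∑ equations (λ e → ⟦ spoiled? u I j e ω ⟧))) {v = V ^ 2} (λ {I} _ →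
          ∑∑-≤ Ω (allFin H) (λ j ω → ∑ equations (λ e → ⟦ spoiled? u I j e ω ⟧)) {v = V ^ 2} (λ {j} _ →
            ∑∑-≤ Ω equations (λ e ω → ⟦ spoiled? u I j e ω ⟧) {v = V ^ 2} (spoiled-bound u I j)))))
      dbl : V ^ 2 * Sd ≤ s * (s * W)
      dbl = subst (λ a → V ^ 2 * Sd ≤ a * (a * W)) length-selections
        (∑∑-≤ Ω selections (λ I ω → ∑ selections (λ J → ⟦ double? u I J ω ⟧)) {v = V ^ 2} (λ {I} _ →
          ∑∑-≤ Ω selections (λ J ω → ⟦ double? u I J ω ⟧) {v = V ^ 2} (λ {J} _ → double-bound u I J)))

    good-sample : (U : List ℕ) → (∀ {u} → u ∈ U → H * B + H′ * ℓ ≤ u × u < H * B + V) →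
      2 * Z ^ H′ * (H * (h * (length A + N) ^ H′) + k ^ H) ≤ V →
      ∃[ ω ] (ω ∈ Ω × length U * k ^ H ≤ 2 * (V * Z ^ H′) * ∑ U (λ u → ⟦ represented? u ω ⟧))
    good-sample U range small =
      ∃≥average Ω _ _ (subst (0 <_) (sym length-Ω) (m^n>0 V {{>-nonZero (<-≤-trans 0<ℓ ℓ≤V)}} N)) (begin
        length Ω * (length U * k ^ H)
          ≡⟨ solve 3 (λ w u s → w :* (u :* s) := u :* (s :* w)) refl (length Ω) (length U) (k ^ H) ⟩
        length U * (k ^ H * length Ω)
          ≤⟨ ∑∑-≥ Ω U (λ u ω → ⟦ represented? u ω ⟧) {v = 2 * (V * Z ^ H′)}
               (λ u∈ → expected-representation (proj₁ (range u∈)) (proj₂ (range u∈)) small) ⟩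
        2 * (V * Z ^ H′) * ∑ Ω (λ ω → ∑ U (λ u → ⟦ represented? u ω ⟧))
          ≡⟨ *-distribˡ-∑ Ω (2 * (V * Z ^ H′)) _ ⟩
        ∑ Ω (λ ω → 2 * (V * Z ^ H′) * ∑ U (λ u → ⟦ represented? u ω ⟧)) ∎)
      where
      open ≤-Reasoning

-- Extending a B_h[1]-set

-- The lower bound on new elements is what makes membership in the limit set decidable.
Grows : ℕ → List ℕ → List ℕ → Set
Grows B A A′ = (∀ {a} → a ∈ A → a ∈ A′) × (∀ {a} → a ∈ A′ → a ∈ A ⊎ B ≤ a)

Grows-refl : ∀ {B A} → Grows B A A
Grows-refl = id , inj₁

Grows-trans : ∀ {B A A′ A″} → Grows B A A′ → Grows B A′ A″ → Grows B A A″
Grows-trans (f , g) (f′ , g′) = f′ ∘ f , [ g , inj₂ ]′ ∘ g′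

-- Positivity of the terms rules out the auxiliary element 0, as a basis of order exactly `m` is
-- wanted.
IsSum : ℕ → List ℕ → ℕ → Set
IsSum m A u = ∃[ v ] (All (_∈ A) {m} v × All (0 <_) v × sum v ≡ u)

IsSum-mono : ∀ {m A A′ u} → (∀ {a} → a ∈ A → a ∈ A′) → IsSum m A u → IsSum m A′ u
IsSum-mono sub (v , v∈ , pos , eq) = v , All.map sub v∈ , pos , eq

-- `U′` holds the targets still uncovered. `shrinks` keeps them in the admissible range and `fewer`
-- controls their number.
record Round (h′ B : ℕ) (A U : List ℕ) (added : ℕ) : Set where
  field
    A′ U′     : List ℕ
    grows     : Grows B A A′
    unique    : UniqueSums (suc h′) A′
    size      : length A′ ≤ added + length A
    shrinks   : ∀ {u} → u ∈ U′ → u ∈ U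
    fewer     : length U′ ≤ length U
    covers    : ∀ {u} → u ∈ U → IsSum (suc (h′ + suc h′)) A′ u ⊎ u ∈ U′

open Round

module Adjoining (h′ k B V : ℕ) (A : List ℕ) (0<B : 0 < B) (0∈A : 0 ∈ A) (uniqueA : UniqueSums (suc h′) A) where
  open Sampling h′ k B V A

  adjoin : Vec ℕ N → List (Fin N) → List ℕ
  adjoin ω is = map (lookup ω) is ++ A

  -- Turns a numerical equation over the adjoined set into a symbolic one. An element obtained from
  -- `is` becomes its coordinate, which differs from `i`.
  lift : ∀ {n ω i is} {v : Vec ℕ n} → i ∉ is → All (_∈ adjoin ω is) v →
         ∃[ ts ] (All (_∈ terms) {n} ts × inj₂ i ∉ᵛ ts × total ω ts ≡ sum v)
  lift i∉ [] = [] , [] , (λ ()) , refl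
  lift {ω = ω} {i} {is} i∉ (_∷_ {x = x} a∈ v∈) with lift i∉ v∈ | ∈-++⁻ (map (lookup ω) is) a∈
  ... | ts , ts∈ , i∉ts , eq | inj₂ a∈A =
    inj₁ x ∷ ts , ∈-++⁺ˡ (∈-map⁺ inj₁ a∈A) ∷ ts∈ , (λ { (VecAny.there p) → i∉ts p }) , cong (x +_) eq
  ... | ts , ts∈ , i∉ts , eq | inj₁ a∈is with ∈-map⁻ (lookup ω) a∈is
  ...   | j , j∈ , refl =
    inj₂ j ∷ ts , ∈-++⁺ʳ (map inj₁ A) (∈-map⁺ inj₂ (∈-allFin j)) ∷ ts∈ ,
    (λ { (VecAny.here refl) → i∉ j∈ ; (VecAny.there p) → i∉ts p }) , cong (lookup ω j +_) eq

  -- Coordinates are adjoined one at a time. A violation of `Fresh` would lift to a member of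
  -- `equations` and make the new coordinate clash.
  adjoin-unique : ∀ {ω is} → Unique is → (∀ {i} → i ∈ is → ¬ Clashing ω i) → UniqueSums h (adjoin ω is)
  adjoin-unique {is = []} _ good = uniqueA
  adjoin-unique {ω} {i ∷ is} (i≢ ∷ u) good =
    UniqueSums-∷ (∈-++⁺ʳ (map (lookup ω) is) 0∈A) (adjoin-unique u (good ∘ there)) fresh
    where
    i∉ : i ∉ is
    i∉ i∈ = ListAll.lookup i≢ i∈ refl
    fresh : Fresh h′ (lookup ω i) (adjoin ω is)
    fresh {suc c} 0<c c≤h α∈ β∈ eq with lift i∉ α∈ | lift i∉ β∈
    ... | α , α∈′ , i∉α , α≡ | β , β∈′ , i∉β , β≡ =
      good (here refl) (lose {x = suc c , α , β}
        (∈-cartesianProduct⁺ (∈-map⁺ (1 +_) (∈-upTo⁺ c≤h)) (∈-cartesianProduct⁺ (∈-vecs α∈′) (∈-vecs β∈′)))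
        (i∉α , i∉β , trans (cong (suc c * lookup ω i +_) α≡) (trans eq (sym β≡))))

  -- Clashes are tested against all coordinates, discarded ones included, so survival does not
  -- depend on the order of adjoining.
  survivors : Vec ℕ N → List (Fin N)
  survivors ω = filter (¬? ∘ clashing? ω) (allFin N)

  A⁺ : Vec ℕ N → List ℕ
  A⁺ ω = adjoin ω (survivors ω)

  in-window : ∀ {ω} → ω ∈ Ω → ∀ i → B ≤ lookup ω i
  in-window ω∈ i with ∈-applyUpTo⁻ (B +_) (All.lookup⁺ (∈-vecs⁻ ω∈) i)
  ... | x , _ , eq = ≤-trans (m≤m+n B x) (≤-reflexive (sym eq))

  A⁺-grows : ∀ {ω} → ω ∈ Ω → Grows B A (A⁺ ω)
  A⁺-grows {ω} ω∈ = ∈-++⁺ʳ (map (lookup ω) (survivors ω)) , back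
    where
    back : ∀ {a} → a ∈ A⁺ ω → a ∈ A ⊎ B ≤ a
    back a∈ with ∈-++⁻ (map (lookup ω) (survivors ω)) a∈
    ... | inj₂ a∈A = inj₁ a∈A
    ... | inj₁ a∈′ with ∈-map⁻ (lookup ω) a∈′
    ...   | i , _ , refl = inj₂ (in-window ω∈ i)

  A⁺-length : ∀ ω → length (A⁺ ω) ≤ N + length A
  A⁺-length ω = begin
    length (A⁺ ω)                                      ≡⟨ length-++ (map (lookup ω) (survivors ω)) ⟩
    length (map (lookup ω) (survivors ω)) + length A   ≡⟨ cong (_+ length A) (length-map (lookup ω) (survivors ω)) ⟩
    length (survivors ω) + length A                    ≤⟨ +-monoˡ-≤ (length A) (length-filter (¬? ∘ clashing? ω) (allFin N)) ⟩
    length (allFin N) + length A                       ≡⟨ cong (_+ length A) (length-tabulate {n = N} (λ i → i)) ⟩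
    N + length A                                       ∎
    where open ≤-Reasoning

  represented⇒IsSum : ∀ {ω u} → ω ∈ Ω → Represented u ω → IsSum H (A⁺ ω) u
  represented⇒IsSum {ω} ω∈ r with find r
  ... | I , _ , rep , good =
    tabulate (λ j → lookup ω (cell I j)) ,
    All.tabulate⁺ (λ j → ∈-++⁺ˡ (∈-map⁺ (lookup ω) (∈-filter⁺ (¬? ∘ clashing? ω) (∈-allFin (cell I j)) (good j)))) ,
    All.tabulate⁺ (λ j → <-≤-trans 0<B (in-window ω∈ (cell I j))) ,
    trans (cong sum (tabulate-∘ (value ω) (λ j → inj₂ (cell I j)))) rep

  record-round : ∀ U D {ω} → ω ∈ Ω → length U * k ^ H ≤ D * ∑ U (λ u → ⟦ represented? u ω ⟧) →
                 ∃[ r ] (k ^ H * length U + D * length (U′ {h′} {B} {A} {U} {N} r) ≤ D * length U)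
  record-round U D {ω} ω∈ gain = record
    { A′       = A⁺ ω
    ; U′       = filter (λ u → ¬? (represented? u ω)) U
    ; grows    = A⁺-grows ω∈
    ; unique   = adjoin-unique (Unique.filter⁺ (¬? ∘ clashing? ω) (Unique.allFin⁺ N))
                   (λ i∈ → proj₂ (∈-filter⁻ (¬? ∘ clashing? ω) {xs = allFin N} i∈))
    ; size     = A⁺-length ω
    ; shrinks  = λ u∈ → proj₁ (∈-filter⁻ unrep? {xs = U} u∈)
    ; fewer    = length-filter unrep? U
    ; covers   = cover
    } , progress
    where
    open ≤-Reasoning
    unrep? : ∀ u → Dec (¬ Represented u ω)
    unrep? = λ u → ¬? (represented? u ω)
    c = ∑ U (λ u → ⟦ represented? u ω ⟧)
    progress : k ^ H * length U + D * length (filter unrep? U) ≤ D * length U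
    progress = begin
      k ^ H * length U + D * length (filter unrep? U) ≡⟨ cong (_+ D * length (filter unrep? U)) (*-comm (k ^ H) (length U)) ⟩
      length U * k ^ H + D * length (filter unrep? U) ≤⟨ +-monoˡ-≤ (D * length (filter unrep? U)) gain ⟩
      D * c + D * length (filter unrep? U)            ≡⟨ *-distribˡ-+ D c (length (filter unrep? U)) ⟨
      D * (c + length (filter unrep? U))              ≡⟨ cong (D *_) (length-filter-¬ (λ u → represented? u ω) U) ⟩
      D * length U                     ∎
    cover : ∀ {u} → u ∈ U → IsSum H (A⁺ ω) u ⊎ u ∈ filter unrep? U
    cover {u} u∈ = split (represented? u ω)
      where
      split : Dec (Represented u ω) → IsSum H (A⁺ ω) u ⊎ u ∈ filter unrep? U
      split (yes r) = inj₁ (represented⇒IsSum ω∈ r)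
      split (no ¬r) = inj₂ (∈-filter⁺ unrep? u∈ ¬r)

  round : ∀ {ℓ Z} → 0 < ℓ → V ≡ Z * ℓ → ℓ ≤ V →
    (U : List ℕ) → (∀ {u} → u ∈ U → H * B + H′ * ℓ ≤ u × u < H * B + V) →
    2 * Z ^ H′ * (H * (h * (length A + N) ^ H′) + k ^ H) ≤ V →
    ∃[ r ] (k ^ H * length U + 2 * (V * Z ^ H′) * length (U′ {h′} {B} {A} {U} {N} r) ≤ 2 * (V * Z ^ H′) * length U)
  round {ℓ} {Z} 0<ℓ V≡ ℓ≤V U range small =
    let ω , ω∈ , gain = good-sample 0<ℓ V≡ ℓ≤V U range small
    in record-round U (2 * (V * Z ^ H′)) ω∈ gain

∉-empty : ∀ {x : ℕ} (xs : List ℕ) → length xs ≡ 0 → x ∈ xs → ⊥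
∉-empty [] _ ()

Round-refl : ∀ {h′ B A U} → UniqueSums (suc h′) A → Round h′ B A U 0
Round-refl {B = B} {A} {U} uniq = record
  { A′ = A ; U′ = U ; grows = Grows-refl {B} ; unique = uniq ; size = ≤-refl
  ; shrinks = id ; fewer = ≤-refl ; covers = inj₂ }

Round-trans : ∀ {h′ B A U a b} (r : Round h′ B A U a) → Round h′ B (A′ r) (U′ r) b → Round h′ B A U (b + a)
Round-trans {B = B} {A} {a = a} {b} r s = record
  { A′      = A′ s
  ; U′      = U′ s
  ; grows   = Grows-trans {B} (grows r) (grows s)
  ; unique  = unique s
  ; size    = ≤-trans (size s) (≤-trans (+-monoʳ-≤ b (size r)) (≤-reflexive (sym (+-assoc b a (length A)))))
  ; shrinks = shrinks r ∘ shrinks s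
  ; fewer   = ≤-trans (fewer s) (fewer r)
  ; covers  = λ u∈ → [ inj₁ ∘ IsSum-mono (proj₁ (grows s)) , covers s ]′ (covers r u∈)
  }

-- Repeating rounds until every target is covered

module Iteration
  (h′ k B V ℓ Z M Q : ℕ) (0<k : 0 < k) (0<B : 0 < B) (0<ℓ : 0 < ℓ) (0<Q : 0 < Q)
  (V≡Zℓ : V ≡ Z * ℓ) (ℓ≤V : ℓ ≤ V)
  (small : 2 * Z ^ (h′ + suc h′) * (suc (h′ + suc h′) * (suc h′ * M ^ (h′ + suc h′)) + k ^ suc (h′ + suc h′)) ≤ V)
  (D≡sQ : 2 * (V * Z ^ (h′ + suc h′)) ≡ k ^ suc (h′ + suc h′) * Q)
  where

  private
    H′ H : ℕ
    H′ = h′ + suc h′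
    H  = suc H′

  Admissible : List ℕ → Set
  Admissible U = ∀ {u} → u ∈ U → H * B + H′ * ℓ ≤ u × u < H * B + V

  -- Cancelling `k ^ H` from the progress inequality shows that at least a proportion `1 / Q` of `U`
  -- is covered. The cap `M` lets the single hypothesis `small` serve every round.
  one-round : ∀ {A U} → 0 ∈ A → UniqueSums (suc h′) A → Admissible U → H * k + length A ≤ M →
              ∃[ r ] (length U + Q * length (U′ {h′} {B} {A} {U} {H * k} r) ≤ Q * length U)
  one-round {A} {U} 0∈A uniq adm budget =
    let r , progress = Adjoining.round h′ k B V A 0<B 0∈A uniq 0<ℓ V≡Zℓ ℓ≤V U adm small′
    in r , *-cancelˡ-≤ (k ^ H) {{m^n≢0 k H {{>-nonZero 0<k}}}} (begin
      k ^ H * (length U + Q * length (U′ r))           ≡⟨ *-distribˡ-+ (k ^ H) (length U) _ ⟩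
      k ^ H * length U + k ^ H * (Q * length (U′ r))   ≡⟨ cong (k ^ H * length U +_) (*-assoc (k ^ H) Q _) ⟨
      k ^ H * length U + k ^ H * Q * length (U′ r)     ≡⟨ cong (λ D → k ^ H * length U + D * length (U′ r)) D≡sQ ⟨
      k ^ H * length U + 2 * (V * Z ^ H′) * length (U′ r) ≤⟨ progress ⟩
      2 * (V * Z ^ H′) * length U                      ≡⟨ cong (_* length U) D≡sQ ⟩
      k ^ H * Q * length U                             ≡⟨ *-assoc (k ^ H) Q _ ⟩
      k ^ H * (Q * length U)                           ∎)
    where
    open ≤-Reasoning
    small′ : 2 * Z ^ H′ * (H * (suc h′ * (length A + H * k) ^ H′) + k ^ H) ≤ V
    small′ = ≤-trans (*-monoʳ-≤ (2 * Z ^ H′) (+-monoˡ-≤ (k ^ H) (*-monoʳ-≤ H (*-monoʳ-≤ (suc h′)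
      (^-monoˡ-≤ H′ (≤-trans (≤-reflexive (+-comm (length A) (H * k))) budget)))))) small

  -- Each round removes at least `1 / Q` of what is then uncovered, hence at least `1 / Q` of what
  -- is uncovered at the end. This linear form of geometric decay suffices for halving at `n = Q`.
  rounds : ∀ n {A U} → 0 ∈ A → UniqueSums (suc h′) A → Admissible U → n * (H * k) + length A ≤ M →
           ∃[ r ] (Q * length (U′ {h′} {B} {A} {U} {n * (H * k)} r) + n * length (U′ r) ≤ Q * length U)
  rounds zero    0∈A uniq adm budget = Round-refl uniq , ≤-reflexive (+-identityʳ _)
  rounds (suc n) {A} {U} 0∈A uniq adm budget =
    let r , bound = rounds n 0∈A uniq adm (≤-trans (+-monoˡ-≤ (length A) (m≤n+m (n * (H * k)) (H * k))) budget)
        s , progress = one-round (proj₁ (grows r) 0∈A) (unique r) (adm ∘ shrinks r)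
          (≤-trans (+-monoʳ-≤ (H * k) (size r)) (≤-trans (≤-reflexive (sym (+-assoc (H * k) _ (length A)))) budget))
        x = length (U′ r)
        y = length (U′ s)
    in Round-trans r s , (begin
      Q * y + (y + n * y)   ≤⟨ +-monoʳ-≤ (Q * y) (+-mono-≤ (fewer s) (*-monoʳ-≤ n (fewer s))) ⟩
      Q * y + (x + n * x)   ≡⟨ solve 3 (λ a b c → a :+ (b :+ c) := b :+ a :+ c) refl (Q * y) x (n * x) ⟩
      x + Q * y + n * x     ≤⟨ +-monoˡ-≤ (n * x) progress ⟩
      Q * x + n * x         ≤⟨ bound ⟩
      Q * length U          ∎)
    where open ≤-Reasoning

  -- Every `Q` rounds halve the uncovered set, so `t` halvings leave fewer than one target.
  exhaust : ∀ t {A U} → 0 ∈ A → UniqueSums (suc h′) A → Admissible U → t * (Q * (H * k)) + length A ≤ M →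
            length U < 2 ^ t → ∃[ r ] (length (U′ {h′} {B} {A} {U} {t * (Q * (H * k))} r) ≡ 0)
  exhaust zero    0∈A uniq adm budget few = Round-refl uniq , n≤0⇒n≡0 (s≤s⁻¹ few)
  exhaust (suc t) {A} {U} 0∈A uniq adm budget few =
    let X = Q * (H * k)
        r , bound = rounds Q 0∈A uniq adm (≤-trans (+-monoˡ-≤ (length A) (m≤m+n X (t * X))) budget)
        x = length (U′ r)
        halved : 2 * x ≤ length U
        halved = *-cancelˡ-≤ Q {{>-nonZero 0<Q}} (≤-trans (≤-reflexive
          (solve 2 (λ q x → q :* (con 2 :* x) := q :* x :+ q :* x) refl Q x)) bound)
        s , done = exhaust t (proj₁ (grows r) 0∈A) (unique r) (adm ∘ shrinks r)
          (≤-trans (+-monoʳ-≤ (t * X) (size r)) (≤-trans (≤-reflexive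
            (solve 3 (λ a b c → b :+ (a :+ c) := a :+ b :+ c) refl X (t * X) (length A))) budget))
          (*-cancelˡ-< 2 x (2 ^ t) (≤-<-trans halved few))
    in subst (λ a → ∃[ r ] (length (U′ {h′} {B} {A} {U} {a} r) ≡ 0)) (+-comm (t * X) X) (Round-trans r s , done)

  cover-all : ∀ t {A} U → 0 ∈ A → UniqueSums (suc h′) A → Admissible U → t * (Q * (H * k)) + length A ≤ M →
              length U < 2 ^ t →
              ∃[ A′ ] (Grows B A A′ × UniqueSums (suc h′) A′ × length A′ ≤ M × (∀ {u} → u ∈ U → IsSum H A′ u))
  cover-all t U 0∈A uniq adm budget few =
    let r , done = exhaust t 0∈A uniq adm budget few
    in A′ r , grows r , unique r , ≤-trans (size r) budget ,
       λ u∈ → [ id , (λ u∈′ → ⊥-elim (∉-empty (U′ r) done u∈′)) ]′ (covers r u∈)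

-- Choice of the parameters

n<2^n : ∀ n → n < 2 ^ n
n<2^n zero    = s≤s z≤n
n<2^n (suc n) = begin
  suc (suc n)     ≤⟨ s≤s (n<2^n n) ⟩
  1 + 2 ^ n       ≤⟨ +-monoˡ-≤ (2 ^ n) (m^n>0 2 n) ⟩
  2 ^ n + 2 ^ n   ≡⟨ cong (2 ^ n +_) (+-identityʳ _) ⟨
  2 ^ suc n       ∎
  where open ≤-Reasoning

m≤m*n′ : ∀ m {n} → 0 < n → m ≤ m * n
m≤m*n′ m {n} 0<n = m≤m*n m n {{>-nonZero 0<n}}

m≤n*m′ : ∀ m {n} → 0 < n → m ≤ n * m
m≤n*m′ m {n} 0<n = m≤n*m m n {{>-nonZero 0<n}}

-- A stage with base q starts from a set of at most q^(d+3) elements and uses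
-- groups of q^d cells and a window of length (2q)^D.  The exponents are chosen
-- so that q^D = q · (q^d)^H, whereas (q^(d+3))^(H−1) = (q^d)^H; the remaining
-- factor q ≥ c absorbs all constants depending on h.
module Stage (h′ : ℕ) where

  H′ H d D Z C c′ c : ℕ
  H′ = h′ + suc h′
  H  = suc H′
  -- This solves `(d + 3) * H′ = d * H`.
  d  = 3 * H′
  D  = suc (d * H)
  -- The ratio `V / ℓ`, the same in all stages, so that `C` is a constant.
  Z  = 2 ^ D * (2 * H)
  C  = Z ^ H′
  -- The first summand is the constant met in `added`, the second the one met in `small`.
  c′ = 4 * (2 ^ D * (D * (C * H))) + 2 * C * (H * (suc h′ * 2 ^ H′) + 1)
  -- The factor `2 * H` makes `q j ^ D / (2 * H)` an integer, namely `ℓ`.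
  c  = 2 * H * c′

  0<2^D : 0 < 2 ^ D
  0<2^D = m^n>0 2 D

  0<Z : 0 < Z
  0<Z = *-mono-< 0<2^D (s≤s (z≤n {H′ + suc (H′ + 0)}))

  0<C : 0 < C
  0<C = m^n>0 Z {{>-nonZero 0<Z}} H′

  0<c′ : 0 < c′
  0<c′ = ≤-trans (*-mono-≤ (*-mono-≤ (s≤s (z≤n {1})) 0<C) (m≤n+m 1 _)) (m≤n+m _ (4 * (2 ^ D * (D * (C * H)))))

  c′≤c : c′ ≤ c
  c′≤c = m≤n*m′ c′ (s≤s (z≤n {H′ + suc (H′ + 0)}))

  q : ℕ → ℕ
  q j = c * 2 ^ j

  q-suc : ∀ j → q (suc j) ≡ 2 * q j
  q-suc j = solve 2 (λ c p → c :* (con 2 :* p) := con 2 :* (c :* p)) refl c (2 ^ j)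

  c≤q : ∀ j → c ≤ q j
  c≤q j = m≤m*n′ c (m^n>0 2 j)

  0<c : 0 < c
  0<c = ≤-trans 0<c′ c′≤c

  0<q : ∀ j → 0 < q j
  0<q j = ≤-trans 0<c (c≤q j)

  n<q^D : ∀ n → n < q n ^ D
  n<q^D n = <-≤-trans (n<2^n n) (≤-trans (m≤n*m′ (2 ^ n) 0<c)
    (m≤m*n (q n) (q n ^ (d * H)) {{m^n≢0 (q n) (d * H) {{>-nonZero (0<q n)}}}}))

  module _ (j : ℕ) where

    private
      Q g s ℓ V M N t : ℕ
      Q = 2 * (2 ^ D * (q j * C))
      g = q j ^ d
      s = q j ^ (d * H)
      ℓ = s * (c′ * 2 ^ j)
      -- Equal to `q (suc j) ^ D`, so the targets of consecutive stages are adjacent intervals.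
      V = (2 * q j) ^ D
      M = 2 * q j ^ (d + 3)
      N = H * g
      -- As `c < 2 ^ c`, this gives `V < 2 ^ t`: enough halvings to use up all targets.
      t = (1 + c + j) * D

      0<s : 0 < s
      0<s = m^n>0 (q j) {{>-nonZero (0<q j)}} (d * H)

      k^H≡s : g ^ H ≡ s
      k^H≡s = ^-*-assoc (q j) d H

      V≡ : V ≡ 2 ^ D * (q j * s)
      V≡ = ^-distribʳ-* D 2 (q j)

      q^D≡ : q j ^ D ≡ 2 * H * ℓ
      q^D≡ = solve 4 (λ h c p s → h :* c :* p :* s := h :* (s :* (c :* p))) refl (2 * H) c′ (2 ^ j) s

      V≡Zℓ : V ≡ Z * ℓ
      V≡Zℓ = trans V≡ (trans (cong (2 ^ D *_) q^D≡) (sym (*-assoc (2 ^ D) (2 * H) ℓ)))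

      j<ℓ : suc j ≤ ℓ
      j<ℓ = ≤-trans (n<2^n j) (≤-trans (m≤n*m′ (2 ^ j) 0<c′) (m≤n*m′ (c′ * 2 ^ j) 0<s))

      ℓ≤V : ℓ ≤ V
      ℓ≤V = ≤-trans (m≤n*m′ ℓ 0<Z) (≤-reflexive (sym V≡Zℓ))

      D≡sQ : 2 * (V * C) ≡ g ^ H * Q
      D≡sQ = begin
        2 * (V * C)                     ≡⟨ cong (λ v → 2 * (v * C)) V≡ ⟩
        2 * (2 ^ D * (q j * s) * C)     ≡⟨ solve 4 (λ e q s c → con 2 :* (e :* (q :* s) :* c) := s :* (con 2 :* (e :* (q :* c)))) refl (2 ^ D) (q j) s C ⟩
        s * Q                           ≡⟨ cong (_* Q) k^H≡s ⟨
        g ^ H * Q                       ∎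
        where open ≡-Reasoning

      M^H′≡ : M ^ H′ ≡ 2 ^ H′ * s
      M^H′≡ = begin
        (2 * q j ^ (d + 3)) ^ H′        ≡⟨ ^-distribʳ-* H′ 2 (q j ^ (d + 3)) ⟩
        2 ^ H′ * (q j ^ (d + 3)) ^ H′   ≡⟨ cong (2 ^ H′ *_) (^-*-assoc (q j) (d + 3) H′) ⟩
        2 ^ H′ * q j ^ ((d + 3) * H′)   ≡⟨ cong (λ e → 2 ^ H′ * q j ^ e) (solve 1 (λ h → (con 3 :* h :+ con 3) :* h := con 3 :* h :* (con 1 :+ h)) refl H′) ⟩
        2 ^ H′ * s                      ∎
        where open ≡-Reasoning

      small : 2 * C * (H * (suc h′ * M ^ H′) + g ^ H) ≤ V
      small = begin
        2 * C * (H * (suc h′ * M ^ H′) + g ^ H)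
          ≡⟨ cong₂ (λ a b → 2 * C * (H * (suc h′ * a) + b)) M^H′≡ k^H≡s ⟩
        2 * C * (H * (suc h′ * (2 ^ H′ * s)) + s)
          ≡⟨ solve 5 (λ c h g p s → con 2 :* c :* (h :* (g :* (p :* s)) :+ s) := con 2 :* c :* (h :* (g :* p) :+ con 1) :* s) refl C H (suc h′) (2 ^ H′) s ⟩
        2 * C * (H * (suc h′ * 2 ^ H′) + 1) * s
          ≤⟨ *-monoˡ-≤ s (≤-trans (m≤n+m _ (4 * (2 ^ D * (D * (C * H))))) (≤-trans c′≤c (c≤q j))) ⟩
        q j * s
          ≤⟨ m≤n*m′ (q j * s) 0<2^D ⟩
        2 ^ D * (q j * s)
          ≡⟨ V≡ ⟨
        V ∎
        where open ≤-Reasoning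

      t≤ : 1 + c + j ≤ 2 * q j
      t≤ = begin
        1 + c + j     ≡⟨ solve 2 (λ c j → con 1 :+ c :+ j := c :+ (con 1 :+ j)) refl c j ⟩
        c + suc j     ≤⟨ +-mono-≤ (c≤q j) (≤-trans (n<2^n j) (m≤n*m′ (2 ^ j) 0<c)) ⟩
        q j + q j     ≡⟨ cong (q j +_) (+-identityʳ (q j)) ⟨
        2 * q j       ∎
        where open ≤-Reasoning

      -- Up to constants, `t` and `Q` are at most `q` and `N` is `q ^ d`; the third factor `q`
      -- absorbs the constants.
      added : t * (Q * N) ≤ q j ^ (d + 3)
      added = begin
        (1 + c + j) * D * (2 * (2 ^ D * (q j * C)) * (H * g))
          ≤⟨ *-monoˡ-≤ (2 * (2 ^ D * (q j * C)) * (H * g)) (*-monoˡ-≤ D t≤) ⟩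
        2 * q j * D * (2 * (2 ^ D * (q j * C)) * (H * g))
          ≡⟨ solve 6 (λ q d e c h g → con 2 :* q :* d :* (con 2 :* (e :* (q :* c)) :* (h :* g))
                := g :* (q :* (q :* (con 4 :* (e :* (d :* (c :* h))))))) refl (q j) D (2 ^ D) C H g ⟩
        g * (q j * (q j * (4 * (2 ^ D * (D * (C * H))))))
          ≤⟨ *-monoʳ-≤ g (*-monoʳ-≤ (q j) (*-monoʳ-≤ (q j) (≤-trans (m≤m+n _ (2 * C * (H * (suc h′ * 2 ^ H′) + 1))) (≤-trans c′≤c (c≤q j))))) ⟩
        g * (q j * (q j * q j))
          ≡⟨ cong (λ x → g * (q j * (q j * x))) (*-identityʳ (q j)) ⟨
        g * q j ^ 3
          ≡⟨ ^-distribˡ-+-* (q j) d 3 ⟨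
        q j ^ (d + 3) ∎
        where open ≤-Reasoning

      V<2^t : V < 2 ^ t
      V<2^t = subst (V <_) (^-*-assoc 2 (1 + c + j) D) (^-monoˡ-< D (begin-strict
        2 * (c * 2 ^ j)       <⟨ *-monoʳ-< 2 (*-monoˡ-< (2 ^ j) {{m^n≢0 2 j}} (n<2^n c)) ⟩
        2 * (2 ^ c * 2 ^ j)   ≡⟨ cong (2 *_) (^-distribˡ-+-* 2 c j) ⟨
        2 ^ (1 + c + j)       ∎))
        where open ≤-Reasoning

      targets : List ℕ
      targets = applyUpTo (q j ^ D +_) (V ∸ q j ^ D)

      q^D≤V : q j ^ D ≤ V
      q^D≤V = ^-monoˡ-≤ D (m≤n*m (q j) 2)

      -- The window starts at `suc j`, which is at most `ℓ`, so the required lower bound stays below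
      -- `2 * H * ℓ = q j ^ D`. This dictates the size of `ℓ`.
      in-range : ∀ {u} → q j ^ D ≤ u → u < V → H * suc j + H′ * ℓ ≤ u × u < H * suc j + V
      in-range {u} lo hi = (begin
        H * suc j + H′ * ℓ   ≤⟨ +-mono-≤ (*-monoʳ-≤ H j<ℓ) (*-monoˡ-≤ ℓ (n≤1+n H′)) ⟩
        H * ℓ + H * ℓ        ≡⟨ solve 2 (λ h l → h :* l :+ h :* l := con 2 :* h :* l) refl H ℓ ⟩
        2 * H * ℓ            ≡⟨ q^D≡ ⟨
        q j ^ D              ≤⟨ lo ⟩
        u                    ∎) , ≤-trans hi (m≤n+m V (H * suc j))
        where open ≤-Reasoning

      targets-in-range : ∀ {u} → u ∈ targets → H * suc j + H′ * ℓ ≤ u × u < H * suc j + V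
      targets-in-range u∈ with ∈-applyUpTo⁻ (q j ^ D +_) u∈
      ... | x , x< , refl = in-range (m≤m+n _ x)
        (<-≤-trans (+-monoʳ-< (q j ^ D) x<) (≤-reflexive (m+[n∸m]≡n q^D≤V)))

      ∈-targets : ∀ {u} → q j ^ D ≤ u → u < V → u ∈ targets
      ∈-targets {u} lo hi = subst (_∈ targets) (m+[n∸m]≡n lo)
        (∈-applyUpTo⁺ (q j ^ D +_) (∸-monoˡ-< hi lo))

      0<k : 0 < g
      0<k = m^n>0 (q j) {{>-nonZero (0<q j)}} d

      0<Q : 0 < Q
      0<Q = *-mono-≤ (s≤s (z≤n {1})) (*-mono-≤ 0<2^D (*-mono-≤ (0<q j) 0<C))

      budget : ∀ {n} → n ≤ q j ^ (d + 3) → t * (Q * N) + n ≤ M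
      budget {n} n≤ = begin
        t * (Q * N) + n                   ≤⟨ +-mono-≤ added n≤ ⟩
        q j ^ (d + 3) + q j ^ (d + 3)     ≡⟨ cong (q j ^ (d + 3) +_) (+-identityʳ _) ⟨
        M                                 ∎
        where open ≤-Reasoning

      -- The size bound may double in a stage because `q` itself doubles.
      M≤ : M ≤ q (suc j) ^ (d + 3)
      M≤ = begin
        2 * q j ^ (d + 3)                 ≤⟨ *-monoˡ-≤ (q j ^ (d + 3)) 2≤ ⟩
        2 ^ (d + 3) * q j ^ (d + 3)       ≡⟨ ^-distribʳ-* (d + 3) 2 (q j) ⟨
        (2 * q j) ^ (d + 3)               ≡⟨ cong (_^ (d + 3)) (q-suc j) ⟨
        q (suc j) ^ (d + 3)               ∎
        where
        open ≤-Reasoning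
        2≤ : 2 ≤ 2 ^ (d + 3)
        2≤ = ≤-trans (m≤n+m 2 (suc d)) (≤-trans (≤-reflexive (sym (+-suc d 2))) (<⇒≤ (n<2^n (d + 3))))

      few : length targets < 2 ^ t
      few = ≤-<-trans (≤-trans (≤-reflexive (length-applyUpTo (q j ^ D +_) (V ∸ q j ^ D))) (m∸n≤m V (q j ^ D))) V<2^t

      module It = Iteration h′ g (suc j) V ℓ Z M Q 0<k (s≤s z≤n) (≤-trans (s≤s z≤n) j<ℓ) 0<Q V≡Zℓ ℓ≤V small D≡sQ

    stage : ∀ {A} → 0 ∈ A → UniqueSums (suc h′) A → length A ≤ q j ^ (d + 3) →
            ∃[ A′ ] (Grows (suc j) A A′ × UniqueSums (suc h′) A′ × length A′ ≤ q (suc j) ^ (d + 3) ×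
                     (∀ {u} → q j ^ D ≤ u → u < q (suc j) ^ D → IsSum H A′ u))
    stage {A} 0∈A uniq size₀ =
      let A′ , grow , uniq′ , size , cover = It.cover-all t targets 0∈A uniq targets-in-range (budget size₀) few
      in A′ , grow , uniq′ , ≤-trans size M≤ ,
         λ {u} lo hi → cover (∈-targets lo (subst (λ x → u < x ^ D) (q-suc j) hi))

-- The limit set

-- The lower bound `b` in front lets the induction ignore which element becomes the new head.
insert-sorted : ∀ {n} {P : Pred ℕ 0ℓ} {b} x {v : Vec ℕ n} → b ≤ x → P x → Linked _≤_ (b ∷ v) → All P v →
                ∃[ w ] (Linked _≤_ (b ∷ w) × All P {suc n} w × sum w ≡ x + sum v)
insert-sorted x {[]} b≤x px _ _ = x ∷ [] , b≤x ∷ [-] , px ∷ [] , refl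
insert-sorted x {y ∷ v} b≤x px (b≤y ∷ l) (py ∷ pv) with ≤-total x y
... | inj₁ x≤y = x ∷ y ∷ v , b≤x ∷ x≤y ∷ l , px ∷ py ∷ pv , refl
... | inj₂ y≤x with insert-sorted x y≤x px l pv
...   | w , l′ , pw , eq = y ∷ w , b≤y ∷ l′ , py ∷ pw ,
  trans (cong (y +_) eq) (trans (sym (+-assoc y x _)) (trans (cong (_+ sum v) (+-comm y x)) (+-assoc x y _)))

sort : ∀ {n} {P : Pred ℕ 0ℓ} {v : Vec ℕ n} → All P v →
       ∃[ w ] (Linked _≤_ (0 ∷ w) × All P {n} w × sum w ≡ sum v)
sort [] = [] , [-] , [] , refl
sort (_∷_ {x = x} px pv) with sort pv
... | w , l , pw , eq with insert-sorted x z≤n px l pw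
...   | w′ , l′ , pw′ , eq′ = w′ , l′ , pw′ , trans eq′ (cong (x +_) eq)

length≤1 : ∀ {A : Set} {xs : List A} → Unique xs → (∀ {x y} → x ∈ xs → y ∈ xs → x ≡ y) → length xs ≤ 1
length≤1 []                      _    = z≤n
length≤1 (_ ∷ [])                _    = s≤s z≤n
length≤1 ((x≢y ListAll.∷ _) ∷ _ ∷ _) same = ⊥-elim (x≢y (same (here refl) (there (here refl))))

module Limit (h′ H : ℕ) (bound start : ℕ → ℕ) (0<bound : 0 < bound 0) (n<start : ∀ n → n < start n)
  (stage : ∀ j {A} → 0 ∈ A → UniqueSums (suc h′) A → length A ≤ bound j →
           ∃[ A′ ] (Grows (suc j) A A′ × UniqueSums (suc h′) A′ × length A′ ≤ bound (suc j) ×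
                    (∀ {u} → start j ≤ u → u < start (suc j) → IsSum H A′ u)))
  where

  record State (j : ℕ) : Set where
    field
      elements     : List ℕ
      0∈elements   : 0 ∈ elements
      uniqueSums   : UniqueSums (suc h′) elements
      length≤bound : length elements ≤ bound j

  open State

  mult-zeros : ∀ {n z} {v : Vec ℕ n} → 0 < z → All (_∈ 0 ∷ []) v → mult z v ≡ 0
  mult-zeros 0<z [] = refl
  mult-zeros {z = z} 0<z (here refl ∷ v∈) = cong₂ _+_ (⟦⟧-no (0 ≟ z) (<⇒≢ 0<z)) (mult-zeros 0<z v∈)

  initial : State 0
  initial = record
    { elements     = 0 ∷ []
    ; 0∈elements   = here refl
    ; uniqueSums   = λ p∈ q∈ _ z 0<z → trans (mult-zeros 0<z p∈) (sym (mult-zeros 0<z q∈))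
    ; length≤bound = 0<bound
    }

  advance : ∀ {j} → State j → State (suc j)
  advance {j} s =
    let A′ , grow , uniq , len , _ = stage j (0∈elements s) (uniqueSums s) (length≤bound s)
    in record { elements = A′ ; 0∈elements = proj₁ grow (0∈elements s) ; uniqueSums = uniq ; length≤bound = len }

  state : ∀ j → State j
  state zero    = initial
  state (suc j) = advance (state j)

  chain : ℕ → List ℕ
  chain j = elements (state j)

  chain-grows : ∀ j → Grows (suc j) (chain j) (chain (suc j))
  chain-grows j = proj₁ (proj₂ (stage j (0∈elements (state j)) (uniqueSums (state j)) (length≤bound (state j))))

  chain-covers : ∀ j {u} → start j ≤ u → u < start (suc j) → IsSum H (chain (suc j)) u
  chain-covers j = proj₂ (proj₂ (proj₂ (proj₂ (stage j (0∈elements (state j)) (uniqueSums (state j)) (length≤bound (state j))))))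

  chain-mono : ∀ i {j a} → a ∈ chain j → a ∈ chain (i + j)
  chain-mono zero    a∈ = a∈
  chain-mono (suc i) {j} a∈ = proj₁ (chain-grows (i + j)) (chain-mono i a∈)

  chain-mono-≤ : ∀ {i j a} → i ≤ j → a ∈ chain i → a ∈ chain j
  chain-mono-≤ {i} {j} {a} i≤j a∈ = subst (λ m → a ∈ chain m) (m∸n+n≡m i≤j) (chain-mono (j ∸ i) a∈)

  -- Goes back one stage at a time: the step from `i + a` to its successor adds only numbers greater
  -- than `a`.
  settled : ∀ i {a} → a ∈ chain (i + a) → a ∈ chain a
  settled zero    a∈ = a∈
  settled (suc i) {a} a∈ with proj₂ (chain-grows (i + a)) a∈
  ... | inj₁ a∈′ = settled i a∈′
  ... | inj₂ lt  = ⊥-elim (<⇒≱ lt (m≤n+m a i))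

  settles : ∀ j {a} → a ∈ chain j → a ∈ chain a
  settles j {a} a∈ with ≤-total j a
  ... | inj₁ j≤a = chain-mono-≤ j≤a a∈
  ... | inj₂ a≤j = settled (j ∸ a) (subst (λ m → a ∈ chain m) (sym (m∸n+n≡m a≤j)) a∈)

  -- Stage j only adds elements greater than j, so membership of a is settled
  -- after a stages.
  limit : PositiveSet
  limit = record
    { Member   = λ a → a ∈ chain a × 0 < a
    ; member?  = λ a → (a ∈? chain a) ×-dec (0 <? a)
    ; positive = proj₂
    }

  -- Descends from `m` to the first stage whose start does not exceed `n`.
  find-stage : ∀ m {n} → start 0 ≤ n → n < start m → ∃[ j ] (start j ≤ n × n < start (suc j))
  find-stage zero    lo hi = ⊥-elim (<⇒≱ hi lo)
  find-stage (suc m) {n} lo hi with start m ≤? n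
  ... | yes le = m , le , hi
  ... | no ¬le = find-stage m lo (≰⇒> ¬le)

  isBasis : IsAsymptoticBasis H limit
  isBasis = start 0 , λ n n> → represent n (find-stage n (<⇒≤ n>) (n<start n))
    where
    represent : ∀ n → ∃[ j ] (start j ≤ n × n < start (suc j)) → R H limit n > 0
    represent n (j , lo , hi) =
      let v , v∈ , pos , sum≡ = chain-covers j lo hi
          w , l , w∈ , sum≡′ = sort {P = Member limit}
            (All.map (λ (a∈ , 0<a) → settles (suc j) a∈ , 0<a) (All.zip (v∈ , pos)))
      in ∈-length (∈-representations⁺ limit (w∈ , Linked.tail l , trans sum≡′ sum≡))

  -- Terms of a representation of `n` are at most `n`, so they all lie in `chain n`. There unique
  -- sums force equal multiplicities, and sorted vectors of positive numbers with equal
  -- multiplicities coincide.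
  isB : IsB (suc h′) 1 limit
  isB n = length≤1 (representations-unique (suc h′) limit n) same
    where
    in-chain : ∀ {v : Vec ℕ (suc h′)} → IsRepresentation limit n v → All (_∈ chain n) v
    in-chain {v} (mem , _ , sum≡) =
      All.map (λ ((a∈ , _) , a∈upTo) → chain-mono-≤ (s≤s⁻¹ (∈-upTo⁻ a∈upTo)) a∈)
        (All.zip (mem , sum≤⇒All∈upTo n v (≤-reflexive sum≡)))
    same : ∀ {v w} → v ∈ representations (suc h′) limit n → w ∈ representations (suc h′) limit n → v ≡ w
    same v∈ w∈ with ∈-representations⁻ limit v∈ | ∈-representations⁻ limit w∈
    ... | rv@(mv , lv , sv) | rw@(mw , lw , sw) =
      sorted-≡ (All.map proj₂ mv) (All.map proj₂ mw) lv lw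
        (uniqueSums (state n) (in-chain rv) (in-chain rw) (trans sv (sym sw)))

theorem1 : ∀ (h : ℕ) → 2 ≤ h →
    ∃[ A ] (IsAsymptoticBasis (2 * h) A × IsB h 1 A)
theorem1 (suc h′) _ = limit , subst (λ k → IsAsymptoticBasis k limit) H≡2h isBasis , isB
  where
  open Stage h′
  open Limit h′ H (λ j → q j ^ (d + 3)) (λ j → q j ^ D)
    (m^n>0 (q 0) {{>-nonZero (0<q 0)}} (d + 3)) n<q^D stage
  H≡2h : suc (h′ + suc h′) ≡ 2 * suc h′
  H≡2h = cong (λ m → suc (h′ + m)) (sym (+-identityʳ (suc h′)))
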